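{- For odd $n\ge 3$, the graph $\mathcal{H}_n$ has maximum degree $n$, and there are exactly two vertices of degree $n$, namely the two matchings in $\mathcal{M}_n$ all of whose edges are perimeter edges. For even $n\ge 2$, the graph $\mathcal{H}_n$ has maximum degree $n/2$.
   Context: Fix an integer $n\ge 2$ and place $2n$ points equidistantly on the unit circle. $\mathcal{M}_n$ is the set of all non-crossing straight-line perfect matchings on these $2n$ points (each has $n$ edges). For $M\in\mathcal{M}_n$, two edges $e,f\in M$ span an empty quadrilateral if the convex hull of $e$ and $f$ contains no other edge of $M$; replacing $e,f$ by the other two edges of this quadrilateral yields another matching of $\mathcal{M}_n$ (a flip). A flip is centered if the closed quadrilateral contains the center of the circle (possibly on its boundary). $\mathcal{H}_n$ is the graph with vertex set $\mathcal{M}_n$ and an edge between two matchings if they differ by a centered flip. For $e\in M$, the length $\ell(e)$ is the minimum, over the two sides of the line through $e$, of the number of other edges of $M$ lying on that side; $e$ is a perimeter edge if $\ell(e)=0$. -}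

module Defs where

open import Data.Nat using (ℕ; zero; suc; _+_; _*_; _<_; _≤_; _⊔_; _⊓_; _<ᵇ_)
open import Data.Bool using (Bool; true; false; if_then_else_; _∧_; _∨_)
open import Data.Fin using (Fin; toℕ) renaming (zero to fzero; suc to fsuc)
open import Data.Vec using (Vec; lookup)
open import Data.List using (List; length; _∷_; [])
open import Data.List.Membership.Propositional using (_∈_)
open import Data.List.Relation.Unary.Unique.Propositional using (Unique)
open import Data.List.Relation.Unary.Any using (Any)
open import Data.Product using (Σ; ∃; ∃-syntax; _×_; _,_)
open import Data.Sum using (_⊎_)
open import Relation.Nullary using (¬_)
open import Relation.Binary.PropositionalEquality using (_≡_; _≢_)
open import Function.Bundles using (_⇔_)

-- Setting.  The 2n points on the unit circle are labelled 0,1,…,2n-1 in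
-- counterclockwise order; point k sits at angle π·k/n.  Since the points
-- are in convex position, all geometric notions below (crossing of
-- chords, sides of a chord, meeting the interior of an inscribed
-- polygon, containing the centre) are expressed exactly through the
-- cyclic order / positions of the labels.

Pt : ℕ → Set
Pt n = Fin (2 * n)

-- A candidate matching is given by its partner vector:
-- the edge at point i is the chord {i , p ⟨ i ⟩}.
-- (stated for an arbitrary number m of points; we use m = 2n)
Conf′ : ℕ → Set
Conf′ m = Vec (Fin m) m

Conf : ℕ → Set
Conf n = Conf′ (2 * n)

_⟨_⟩ : ∀ {m} → Conf′ m → Fin m → Fin m
p ⟨ i ⟩ = lookup p i

-- x lies strictly inside the arc cut off by chord {a,b} (the side of the
-- line ab not containing the label-0/2n-1 seam) ...
Inside : ∀ {m} → Fin m → Fin m → Fin m → Set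
Inside a b x = (toℕ a < toℕ x × toℕ x < toℕ b) ⊎ (toℕ b < toℕ x × toℕ x < toℕ a)

-- ... or strictly on the other side of the line through a and b.
Outside : ∀ {m} → Fin m → Fin m → Fin m → Set
Outside a b x = (toℕ x < toℕ a × toℕ x < toℕ b) ⊎ (toℕ a < toℕ x × toℕ b < toℕ x)

-- The straight segments ab and cd cross (in a point interior to both).
Crosses : ∀ {m} → Fin m → Fin m → Fin m → Fin m → Set
Crosses a b c d = (Inside a b c × Outside a b d) ⊎ (Outside a b c × Inside a b d)

NonCrossing : ∀ {m} → Conf′ m → Set
NonCrossing p = ∀ i j → ¬ Crosses i (p ⟨ i ⟩) j (p ⟨ j ⟩)

IsMatching : ∀ {m} → Conf′ m → Set
IsMatching p = (∀ i → p ⟨ i ⟩ ≢ i) × (∀ i → p ⟨ p ⟨ i ⟩ ⟩ ≡ i) × NonCrossing p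

DistinctEdges : ∀ {m} → Conf′ m → Fin m → Fin m → Set
DistinctEdges p a c = (c ≢ a) × (c ≢ p ⟨ a ⟩)

OffEdges : ∀ {m} → Conf′ m → Fin m → Fin m → Fin m → Set
OffEdges p a c x = (x ≢ a) × (x ≢ p ⟨ a ⟩) × (x ≢ c) × (x ≢ p ⟨ c ⟩)

-- The segment xy (x, y not vertices of the quadrilateral) meets the
-- interior of the convex quadrilateral with vertices v₁…v₄ (inscribed in
-- the circle) iff quadrilateral vertices lie strictly on both sides of
-- the line xy.
MeetsQuad : ∀ {m} → Fin m → Fin m → Fin m → Fin m → Fin m → Fin m → Set
MeetsQuad x y v₁ v₂ v₃ v₄ =
  (Inside x y v₁ ⊎ Inside x y v₂ ⊎ Inside x y v₃ ⊎ Inside x y v₄) ×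
  (Outside x y v₁ ⊎ Outside x y v₂ ⊎ Outside x y v₃ ⊎ Outside x y v₄)

EmptyQuad : ∀ {m} → Conf′ m → Fin m → Fin m → Set
EmptyQuad p a c =
  ∀ g → OffEdges p a c g →
    ¬ MeetsQuad g (p ⟨ g ⟩) a (p ⟨ a ⟩) c (p ⟨ c ⟩)

-- Point v lies among the n consecutive points i, i+1, …, i+n-1 (mod 2n),
-- i.e. in the open half-circle starting just before point i.
InWindow : (n : ℕ) → Fin (2 * n) → Fin (2 * n) → Set
InWindow n i v =
  (toℕ i ≤ toℕ v × toℕ v < toℕ i + n) ⊎ (toℕ v + 2 * n < toℕ i + n)

-- The closed convex hull of the points v₁…v₄ contains the centre iff the
-- points do not all lie in a common open half-circle.
ContainsCentre : (n : ℕ) → Pt n → Pt n → Pt n → Pt n → Set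
ContainsCentre n v₁ v₂ v₃ v₄ =
  ¬ (∃[ i ] (InWindow n i v₁ × InWindow n i v₂ × InWindow n i v₃ × InWindow n i v₄))

-- q is obtained from p by flipping the edges {a,p a} and {c,p c}: they are
-- replaced by the other two sides of their quadrilateral (the
-- non-crossing one of the two other pairings of a, p a, c, p c).
FlipOf : ∀ {m} → Conf′ m → Fin m → Fin m → Conf′ m → Set
FlipOf p a c q =
  (∀ x → OffEdges p a c x → q ⟨ x ⟩ ≡ p ⟨ x ⟩) ×
  ( ( q ⟨ a ⟩ ≡ c × q ⟨ c ⟩ ≡ a × q ⟨ p ⟨ a ⟩ ⟩ ≡ p ⟨ c ⟩ × q ⟨ p ⟨ c ⟩ ⟩ ≡ p ⟨ a ⟩
    × ¬ Crosses a c (p ⟨ a ⟩) (p ⟨ c ⟩))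
  ⊎ ( q ⟨ a ⟩ ≡ p ⟨ c ⟩ × q ⟨ p ⟨ c ⟩ ⟩ ≡ a × q ⟨ p ⟨ a ⟩ ⟩ ≡ c × q ⟨ c ⟩ ≡ p ⟨ a ⟩
    × ¬ Crosses a (p ⟨ c ⟩) (p ⟨ a ⟩) c))

CentredFlip : (n : ℕ) → Conf n → Conf n → Set
CentredFlip n p q =
  ∃[ a ] ∃[ c ] ( DistinctEdges p a c × EmptyQuad p a c
                × ContainsCentre n a (p ⟨ a ⟩) c (p ⟨ c ⟩)
                × FlipOf p a c q )

Neighbour : (n : ℕ) → Conf n → Conf n → Set
Neighbour n p q = IsMatching q × CentredFlip n p q

HasCard : {A : Set} → (A → Set) → ℕ → Set
HasCard {A} P k =
  Σ (List A) λ L → Unique L × (∀ x → (x ∈ L) ⇔ P x) × length L ≡ k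

DegreeIs : (n : ℕ) → Conf n → ℕ → Set
DegreeIs n p d = HasCard (Neighbour n p) d

MaxDegreeIs : (n : ℕ) → ℕ → Set
MaxDegreeIs n D =
  (∀ p d → IsMatching p → DegreeIs n p d → d ≤ D) ×
  (∃[ p ] (IsMatching p × DegreeIs n p D))

countFin : (m : ℕ) → (Fin m → Bool) → ℕ
countFin zero f = 0
countFin (suc m) f = (if f fzero then 1 else 0) + countFin m (λ i → f (fsuc i))

insideᵇ : ∀ {m} → Fin m → Fin m → Fin m → Bool
insideᵇ a b x = ((toℕ a <ᵇ toℕ x) ∧ (toℕ x <ᵇ toℕ b)) ∨ ((toℕ b <ᵇ toℕ x) ∧ (toℕ x <ᵇ toℕ a))

outsideᵇ : ∀ {m} → Fin m → Fin m → Fin m → Bool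
outsideᵇ a b x = ((toℕ x <ᵇ toℕ a) ∧ (toℕ x <ᵇ toℕ b)) ∨ ((toℕ a <ᵇ toℕ x) ∧ (toℕ b <ᵇ toℕ x))

-- number of edges {i, p i} of p (counted once, via i < p i) lying strictly
-- on the respective side of the line through the edge {a, p a}
sideCount₁ sideCount₂ : (n : ℕ) → Conf n → Pt n → ℕ
sideCount₁ n p a = countFin (2 * n) λ i →
  (toℕ i <ᵇ toℕ (p ⟨ i ⟩)) ∧ insideᵇ a (p ⟨ a ⟩) i ∧ insideᵇ a (p ⟨ a ⟩) (p ⟨ i ⟩)
sideCount₂ n p a = countFin (2 * n) λ i →
  (toℕ i <ᵇ toℕ (p ⟨ i ⟩)) ∧ outsideᵇ a (p ⟨ a ⟩) i ∧ outsideᵇ a (p ⟨ a ⟩) (p ⟨ i ⟩)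

edgeLength : (n : ℕ) → Conf n → Pt n → ℕ
edgeLength n p a = sideCount₁ n p a ⊓ sideCount₂ n p a

PerimeterEdge : (n : ℕ) → Conf n → Pt n → Set
PerimeterEdge n p a = edgeLength n p a ≡ 0

AllPerimeter : (n : ℕ) → Conf n → Set
AllPerimeter n p = ∀ a → PerimeterEdge n p a

{-# OPTIONS --safe #-}
module Submission where

-- In a non-crossing matching every edge joins an even to an odd point, so a flip is determined by
-- the even endpoints a, c of its two edges. If the quadrilateral is centred and empty, then the
-- edge of c separates a from the antipode of a, or the same holds with a and c exchanged. By
-- emptiness the edge of c is the first one met on the way from a to its antipode, hence a
-- determines the flip: there are at most n of them. For even n the antipode of an even point is
-- even, and the flips belonging to antipodal points coincide, which leaves n/2.
-- No vertex of a centred quadrilateral lies behind an edge shorter than a diameter; so if all n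
-- even points occur, nothing lies behind any edge and all edges are perimeter edges. Conversely,
-- for a matching by perimeter edges every even point a is flippable with the edge at its antipode.

open import Defs
open import Data.Bool using (Bool; true; false; _∧_; _∨_; T; if_then_else_)
open import Data.Bool.ListAction using (any)
open import Data.Bool.Properties using (T-∧; T-∨)
open import Data.Empty using (⊥; ⊥-elim)
open import Data.Fin using (Fin; toℕ; fromℕ<)
import Data.Fin as Fin
open import Data.Fin.Properties using (toℕ<n; toℕ-injective; toℕ-fromℕ<)
import Data.Fin.Properties as Fin
open import Data.List using (List; []; _∷_; _++_; length; cartesianProductWith)
import Data.List as List
open import Data.List.Membership.Propositional using (_∈_)
open import Data.List.Membership.Propositional.Properties using (∈-lookup; ∈-tabulate⁺; ∈-tabulate⁻)
open import Data.List.Properties using (length-tabulate)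
open import Data.List.Relation.Unary.All using (All; []; _∷_)
import Data.List.Relation.Unary.All as All
import Data.List.Relation.Unary.All.Properties as All
open import Data.List.Relation.Unary.AllPairs using ([]; _∷_)
open import Data.List.Relation.Unary.Any using (here; there)
open import Data.List.Relation.Unary.Unique.Propositional using (Unique)
open import Data.List.Relation.Unary.Unique.Propositional.Properties using (tabulate⁺)
open import Data.Nat using (ℕ; zero; suc; _+_; _*_; _∸_; _⊓_; _/_; _%_; _≤_; _<_; _≤ᵇ_; _<ᵇ_; z≤n; parity)
open import Data.Nat.DivMod using (m≡m%n+[m/n]*n)
open import Data.Nat.Properties
open import Data.Nat.Tactic.RingSolver using (solve-∀)
open import Data.Parity.Base using (0ℙ; 1ℙ; _⁻¹)
import Data.Parity.Base as ℙ
import Data.Parity.Properties as ℙ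
open import Data.Product using (_×_; _,_; proj₁; proj₂; ∃-syntax)
import Data.Product as Product
open import Data.Sum using (_⊎_; inj₁; inj₂)
import Data.Sum as Sum
open import Data.Unit using (tt)
open import Data.Vec using (Vec; []; _∷_; lookup; tabulate; zipWith; allFin; _[_]≔_)
import Data.Vec as Vec
open import Data.Vec.N-ary using (N-ary; ∀ⁿ; curryⁿ; _$ⁿ_)
open import Data.Vec.Properties using (lookup∘tabulate; tabulate∘lookup; tabulate-cong; lookup∘update; lookup∘update′)
open import Function using (_∘_; id; case_of_)
open import Function.Bundles using (_⇔_; mk⇔; Equivalence)
open import Relation.Binary using (tri<; tri≈; tri>)
open import Relation.Binary.PropositionalEquality
open import Relation.Nullary using (¬_; Dec; yes; no)
open import Relation.Nullary.Decidable using (_×-dec_; _⊎-dec_; _→-dec_; decidable-stable)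


-- The obstacle is the seam between the labels 2n-1 and 0: every statement about arcs splits along
-- it. Positions are therefore measured from a chosen point (`lift`), which turns arcs into
-- intervals, and the case distinctions that remain are comparisons of linear expressions in labels,
-- left to the decision procedure `arith`. Why separation holds in one of the two directions: a and
-- c are opposite corners of the quadrilateral, and being centred means that each of its four arcs
-- has length at most n. Whether c comes before or after the antipode of a then decides which of the
-- two edges does the separating. "Facing" also demands that the antipode lie on the short side of
-- the separating edge. This serves even n: the antipode of a, if it takes part in a centred flip
-- itself, cannot lie behind a short edge, so it must be an end of that edge. Degrees are
-- cardinalities of explicit lists, so upper bounds come from charging neighbours injectively to
-- slots; the same injectivity later shows that a list with one neighbour per slot is complete.

private variable k : ℕ

-- Linear arithmetic over ℕ

-- Coefficients of the variables, then the constant.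
Lin : ℕ → Set
Lin k = Vec ℕ (suc k)

eval : Lin k → Vec ℕ k → ℕ
eval (c ∷ [])         []      = c
eval (a ∷ as@(_ ∷ _)) (x ∷ ρ) = a * x + eval as ρ

_⊞_ : Lin k → Lin k → Lin k
_⊞_ = zipWith _+_

_⊡_ : ℕ → Lin k → Lin k
c ⊡ l = Vec.map (c *_) l

constant : ℕ → Lin k
constant {zero}  c = c ∷ []
constant {suc k} c = 0 ∷ constant c

unit : Fin k → Lin k
unit {suc k} Fin.zero    = 1 ∷ constant 0
unit {suc k} (Fin.suc i) = 0 ∷ unit i

eval-constant : ∀ c (ρ : Vec ℕ k) → eval (constant c) ρ ≡ c
eval-constant c []               = refl
eval-constant c (x ∷ [])         = refl
eval-constant c (x ∷ ρ@(_ ∷ _)) = eval-constant c ρ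

eval-unit : ∀ (i : Fin k) ρ → eval (unit i) ρ ≡ lookup ρ i
eval-unit Fin.zero (x ∷ []) = trans (cong (_+ 0) (+-identityʳ x)) (+-identityʳ x)
eval-unit Fin.zero (x ∷ ρ@(_ ∷ _)) = trans (cong₂ _+_ (+-identityʳ x) (eval-constant 0 ρ)) (+-identityʳ x)
eval-unit (Fin.suc i) (x ∷ ρ@(_ ∷ _)) with unit i | eval-unit i ρ
... | _ ∷ _ | eq = eq

⊞-eval : ∀ (l m : Lin k) ρ → eval (l ⊞ m) ρ ≡ eval l ρ + eval m ρ
⊞-eval (c ∷ []) (d ∷ []) [] = refl
⊞-eval (a ∷ l@(_ ∷ _)) (b ∷ m@(_ ∷ _)) (x ∷ ρ) =
  trans (cong ((a + b) * x +_) (⊞-eval l m ρ)) (distribute a b x (eval l ρ) (eval m ρ))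
  where
  distribute : ∀ a b x y z → (a + b) * x + (y + z) ≡ a * x + y + (b * x + z)
  distribute = solve-∀

⊡-eval : ∀ c (l : Lin k) ρ → eval (c ⊡ l) ρ ≡ c * eval l ρ
⊡-eval c (_ ∷ []) [] = refl
⊡-eval c (a ∷ l@(_ ∷ _)) (x ∷ ρ) =
  trans (cong (c * a * x +_) (⊡-eval c l ρ)) (distribute c a x (eval l ρ))
  where
  distribute : ∀ c a x y → c * a * x + c * y ≡ c * (a * x + y)
  distribute = solve-∀

Ineq : ℕ → Set
Ineq k = Lin k × Lin k

Holds : Vec ℕ k → Ineq k → Set
Holds ρ (l , r) = eval l ρ ≤ eval r ρ

-- Fourier–Motzkin elimination of the first variable: the upper bounds
-- (u , l , r) stand for u * x + l ≤ r and the lower bounds for l ≤ u * x + r.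
record Bounds (k : ℕ) : Set where
  constructor bounds
  field
    frees  : List (Ineq k)
    uppers : List (ℕ × Ineq k)
    lowers : List (ℕ × Ineq k)

HoldsUpper HoldsLower : ℕ → Vec ℕ k → ℕ × Ineq k → Set
HoldsUpper x ρ (u , l , r) = u * x + eval l ρ ≤ eval r ρ
HoldsLower x ρ (u , l , r) = eval l ρ ≤ u * x + eval r ρ

HoldBounds : ℕ → Vec ℕ k → Bounds k → Set
HoldBounds x ρ (bounds fs us ls) =
  All (Holds ρ) fs × All (HoldsUpper x ρ) us × All (HoldsLower x ρ) ls

insert : Ineq (suc k) → Bounds k → Bounds k
insert (a ∷ l , b ∷ r) (bounds fs us ls) with a ∸ b | b ∸ a
... | zero  | zero  = bounds ((l , r) ∷ fs) us ls
... | suc u | _     = bounds fs ((suc u , l , r) ∷ us) ls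
... | zero  | suc v = bounds fs us ((suc v , l , r) ∷ ls)

cancel-common : ∀ a b {x l r} → a * x + l ≤ b * x + r → (a ∸ b) * x + l ≤ (b ∸ a) * x + r
cancel-common zero    zero    h = h
cancel-common zero    (suc b) h = h
cancel-common (suc a) zero    h = h
cancel-common (suc a) (suc b) {x} {l} {r} h = cancel-common a b
  (+-cancelˡ-≤ x _ _ (subst₂ _≤_ (+-assoc x (a * x) l) (+-assoc x (b * x) r) h))

∸-zero : ∀ a b {u} → a ∸ b ≡ suc u → b ∸ a ≡ 0
∸-zero (suc a) zero    _  = refl
∸-zero (suc a) (suc b) eq = ∸-zero a b eq

insert-sound : ∀ x (ρ : Vec ℕ k) c {bs} → Holds (x ∷ ρ) c → HoldBounds x ρ bs →
               HoldBounds x ρ (insert c bs)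
insert-sound x ρ (a ∷ l@(_ ∷ _) , b ∷ r@(_ ∷ _)) h (fs , us , ls)
  with a ∸ b in eq | b ∸ a in eq′ | cancel-common a b {x} h
... | zero  | zero  | h′ = h′ ∷ fs , us , ls
... | suc u | v     | h′ rewrite trans (sym eq′) (∸-zero a b eq) = fs , h′ ∷ us , ls
... | zero  | suc v | h′ = fs , us , h′ ∷ ls

combine : ℕ × Ineq k → ℕ × Ineq k → Ineq k
combine (u , l , r) (v , l′ , r′) = (v ⊡ l) ⊞ (u ⊡ l′) , (v ⊡ r) ⊞ (u ⊡ r′)

combine-sound : ∀ x (ρ : Vec ℕ k) c d → HoldsUpper x ρ c → HoldsLower x ρ d → Holds ρ (combine c d)
combine-sound x ρ (u , l , r) (v , l′ , r′) h h′ =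
  subst₂ _≤_ (expand l l′) (expand r r′)
    (+-cancelˡ-≤ (v * u * x) _ _ (subst₂ _≤_ (left v u x (eval l ρ) (eval l′ ρ))
                                             (right v u x (eval r ρ) (eval r′ ρ))
      (+-mono-≤ (*-monoʳ-≤ v h) (*-monoʳ-≤ u h′))))
  where
  expand : ∀ l l′ → v * eval l ρ + u * eval l′ ρ ≡ eval ((v ⊡ l) ⊞ (u ⊡ l′)) ρ
  expand l l′ = sym (trans (⊞-eval (v ⊡ l) (u ⊡ l′) ρ) (cong₂ _+_ (⊡-eval v l ρ) (⊡-eval u l′ ρ)))
  left : ∀ v u x l l′ → v * (u * x + l) + u * l′ ≡ v * u * x + (v * l + u * l′)
  left = solve-∀
  right : ∀ v u x r r′ → v * r + u * (v * x + r′) ≡ v * u * x + (v * r + u * r′)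
  right = solve-∀

combineAll : List (ℕ × Ineq k) → List (ℕ × Ineq k) → List (Ineq k)
combineAll us ls = cartesianProductWith combine us ls

combineAll-sound : ∀ x (ρ : Vec ℕ k) {us ls} → All (HoldsUpper x ρ) us → All (HoldsLower x ρ) ls →
                   All (Holds ρ) (combineAll us ls)
combineAll-sound x ρ []                   hs = []
combineAll-sound x ρ (_∷_ {x = c} h us) hs =
  All.++⁺ (All.map⁺ (All.map (λ {d} → combine-sound x ρ c d h) hs)) (combineAll-sound x ρ us hs)

trivial : ∀ {m} → Vec ℕ m → Vec ℕ m → Bool
trivial []      []      = true
trivial (a ∷ l) (b ∷ r) = (a ≤ᵇ b) ∧ trivial l r

-- Each elimination may square the number of inequalities. Those that hold at every point of ℕ
-- because of their coefficients alone are discarded to keep the search small.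
prune : List (Ineq k) → List (Ineq k)
prune []             = []
prune ((l , r) ∷ cs) = if trivial l r then prune cs else (l , r) ∷ prune cs

prune-sound : ∀ {ρ : Vec ℕ k} {cs} → All (Holds ρ) cs → All (Holds ρ) (prune cs)
prune-sound []                          = []
prune-sound (_∷_ {x = l , r} h hs) with trivial l r
... | true  = prune-sound hs
... | false = h ∷ prune-sound hs

separate : List (Ineq (suc k)) → Bounds k
separate []       = bounds [] [] []
separate (c ∷ cs) = insert c (separate cs)

separate-sound : ∀ x (ρ : Vec ℕ k) {cs} → All (Holds (x ∷ ρ)) cs → HoldBounds x ρ (separate cs)
separate-sound x ρ []                           = [] , [] , []
separate-sound x ρ (_∷_ {x = c} {xs = cs} h hs) = insert-sound x ρ c {separate cs} h (separate-sound x ρ hs)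

eliminate : Bounds k → List (Ineq k)
-- Each upper bound is also kept with its variable erased: this is its combination with the implicit
-- lower bound 0 ≤ x.
eliminate (bounds fs us ls) = prune (fs ++ List.map proj₂ us ++ combineAll us ls)

eliminate-sound : ∀ x (ρ : Vec ℕ k) {bs} → HoldBounds x ρ bs → All (Holds ρ) (eliminate bs)
eliminate-sound x ρ (fs , us , ls) =
  prune-sound (All.++⁺ fs (All.++⁺
    (All.map⁺ (All.map (λ {c} → ≤-trans (m≤n+m _ (proj₁ c * x))) us))
    (combineAll-sound x ρ us ls)))

contradictory : Ineq 0 → Bool
contradictory (l ∷ [] , r ∷ []) = r <ᵇ l

contradictory-sound : ∀ cs → T (any contradictory cs) → All (Holds []) cs → ⊥
contradictory-sound ((l ∷ [] , r ∷ []) ∷ cs) t (h ∷ hs) with r <ᵇ l in eq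
... | true  = ≤⇒≯ h (<ᵇ⇒< r l (subst T (sym eq) _))
... | false = contradictory-sound cs t hs

-- Without divisibility tests this detects contradictions over the nonnegative rationals only. A
-- contradiction by parity escapes it, so such facts have to be supplied to `arith` as extra
-- hypotheses.
refute : List (Ineq k) → Bool
refute {zero}  cs = any contradictory cs
refute {suc k} cs = refute (eliminate (separate cs))

refute-sound : ∀ (cs : List (Ineq k)) → T (refute cs) → ∀ ρ → All (Holds ρ) cs → ⊥
refute-sound {zero}  cs t []      hs = contradictory-sound cs t hs
refute-sound {suc k} cs t (x ∷ ρ) hs =
  refute-sound (eliminate (separate cs)) t ρ (eliminate-sound x ρ (separate-sound x ρ hs))

-- Quantifier-free formulas

infixl 7 _:*_
infixl 6 _:+_
infix  5 _:≤_ _:<_ _:≡_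
infixr 4 _:∧_
infixr 3 _:∨_
infixr 2 _:⇒_

data Expr (k : ℕ) : Set where
  var  : Fin k → Expr k
  con  : ℕ → Expr k
  _:+_ : Expr k → Expr k → Expr k
  _:*_ : ℕ → Expr k → Expr k

⟦_⟧ₑ : Expr k → Vec ℕ k → ℕ
⟦ var i  ⟧ₑ ρ = lookup ρ i
⟦ con c  ⟧ₑ ρ = c
⟦ s :+ t ⟧ₑ ρ = ⟦ s ⟧ₑ ρ + ⟦ t ⟧ₑ ρ
⟦ c :* t ⟧ₑ ρ = c * ⟦ t ⟧ₑ ρ

linear : Expr k → Lin k
linear (var i)  = unit i
linear (con c)  = constant c
linear (s :+ t) = linear s ⊞ linear t
linear (c :* t) = c ⊡ linear t

linear-eval : ∀ (t : Expr k) ρ → eval (linear t) ρ ≡ ⟦ t ⟧ₑ ρ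
linear-eval (var i)  ρ = eval-unit i ρ
linear-eval (con c)  ρ = eval-constant c ρ
linear-eval (s :+ t) ρ = trans (⊞-eval (linear s) (linear t) ρ) (cong₂ _+_ (linear-eval s ρ) (linear-eval t ρ))
linear-eval (c :* t) ρ = trans (⊡-eval c (linear t) ρ) (cong (c *_) (linear-eval t ρ))

data Formula (k : ℕ) : Set where
  _:≤_ _:<_ _:≡_       : Expr k → Expr k → Formula k
  _:∧_ _:∨_ _:⇒_       : Formula k → Formula k → Formula k
  :⊥                   : Formula k

⟦_⟧ : Formula k → Vec ℕ k → Set
⟦ s :≤ t ⟧ ρ = ⟦ s ⟧ₑ ρ ≤ ⟦ t ⟧ₑ ρ
⟦ s :< t ⟧ ρ = ⟦ s ⟧ₑ ρ < ⟦ t ⟧ₑ ρ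
⟦ s :≡ t ⟧ ρ = ⟦ s ⟧ₑ ρ ≡ ⟦ t ⟧ₑ ρ
⟦ f :∧ g ⟧ ρ = ⟦ f ⟧ ρ × ⟦ g ⟧ ρ
⟦ f :∨ g ⟧ ρ = ⟦ f ⟧ ρ ⊎ ⟦ g ⟧ ρ
⟦ f :⇒ g ⟧ ρ = ⟦ f ⟧ ρ → ⟦ g ⟧ ρ
⟦ :⊥     ⟧ ρ = ⊥

⟦_⟧? : ∀ (f : Formula k) ρ → Dec (⟦ f ⟧ ρ)
⟦ s :≤ t ⟧? ρ = ⟦ s ⟧ₑ ρ ≤? ⟦ t ⟧ₑ ρ
⟦ s :< t ⟧? ρ = ⟦ s ⟧ₑ ρ <? ⟦ t ⟧ₑ ρ
⟦ s :≡ t ⟧? ρ = ⟦ s ⟧ₑ ρ ≟ ⟦ t ⟧ₑ ρ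
⟦ f :∧ g ⟧? ρ = ⟦ f ⟧? ρ ×-dec ⟦ g ⟧? ρ
⟦ f :∨ g ⟧? ρ = ⟦ f ⟧? ρ ⊎-dec ⟦ g ⟧? ρ
⟦ f :⇒ g ⟧? ρ = ⟦ f ⟧? ρ →-dec ⟦ g ⟧? ρ
⟦ :⊥     ⟧? ρ = no id

data NNF (k : ℕ) : Set where
  atom    : Ineq k → NNF k
  both    : NNF k → NNF k → NNF k
  either  : NNF k → NNF k → NNF k

HoldsNNF : Vec ℕ k → NNF k → Set
HoldsNNF ρ (atom c)     = Holds ρ c
HoldsNNF ρ (both f g)   = HoldsNNF ρ f × HoldsNNF ρ g
HoldsNNF ρ (either f g) = HoldsNNF ρ f ⊎ HoldsNNF ρ g

leq : Expr k → Expr k → NNF k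
leq s t = atom (linear s , linear t)

affirm deny : Formula k → NNF k
affirm (s :≤ t) = leq s t
affirm (s :< t) = leq (con 1 :+ s) t
affirm (s :≡ t) = both (leq s t) (leq t s)
affirm (f :∧ g) = both (affirm f) (affirm g)
affirm (f :∨ g) = either (affirm f) (affirm g)
affirm (f :⇒ g) = either (deny f) (affirm g)
affirm :⊥       = leq (con 1) (con 0)
deny (s :≤ t) = leq (con 1 :+ t) s
deny (s :< t) = leq t s
deny (s :≡ t) = either (leq (con 1 :+ s) t) (leq (con 1 :+ t) s)
deny (f :∧ g) = either (deny f) (deny g)
deny (f :∨ g) = both (deny f) (deny g)
deny (f :⇒ g) = both (affirm f) (deny g)
deny :⊥       = leq (con 0) (con 0)

leq-sound : ∀ (s t : Expr k) ρ → ⟦ s ⟧ₑ ρ ≤ ⟦ t ⟧ₑ ρ → HoldsNNF ρ (leq s t)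
leq-sound s t ρ = subst₂ _≤_ (sym (linear-eval s ρ)) (sym (linear-eval t ρ))

affirm-sound : ∀ (f : Formula k) ρ → ⟦ f ⟧ ρ → HoldsNNF ρ (affirm f)
deny-sound   : ∀ (f : Formula k) ρ → ¬ ⟦ f ⟧ ρ → HoldsNNF ρ (deny f)
affirm-sound (s :≤ t) ρ h = leq-sound s t ρ h
affirm-sound (s :< t) ρ h = leq-sound (con 1 :+ s) t ρ h
affirm-sound (s :≡ t) ρ h = leq-sound s t ρ (≤-reflexive h) , leq-sound t s ρ (≤-reflexive (sym h))
affirm-sound (f :∧ g) ρ (h , h′)  = affirm-sound f ρ h , affirm-sound g ρ h′
affirm-sound (f :∨ g) ρ (inj₁ h) = inj₁ (affirm-sound f ρ h)
affirm-sound (f :∨ g) ρ (inj₂ h) = inj₂ (affirm-sound g ρ h)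
affirm-sound (f :⇒ g) ρ h with ⟦ f ⟧? ρ
... | yes f-holds = inj₂ (affirm-sound g ρ (h f-holds))
... | no  f-fails = inj₁ (deny-sound f ρ f-fails)
deny-sound (s :≤ t) ρ h = leq-sound (con 1 :+ t) s ρ (≰⇒> h)
deny-sound (s :< t) ρ h = leq-sound t s ρ (≮⇒≥ h)
deny-sound (s :≡ t) ρ h with <-≤-connex (⟦ s ⟧ₑ ρ) (⟦ t ⟧ₑ ρ)
... | inj₁ s<t = inj₁ (leq-sound (con 1 :+ s) t ρ s<t)
... | inj₂ t≤s = inj₂ (leq-sound (con 1 :+ t) s ρ (≤∧≢⇒< t≤s (h ∘ sym)))
deny-sound (f :∧ g) ρ h with ⟦ f ⟧? ρ
... | yes f-holds = inj₂ (deny-sound g ρ (λ g-holds → h (f-holds , g-holds)))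
... | no  f-fails = inj₁ (deny-sound f ρ f-fails)
deny-sound (f :∨ g) ρ h = deny-sound f ρ (h ∘ inj₁) , deny-sound g ρ (h ∘ inj₂)
deny-sound (f :⇒ g) ρ h =
  affirm-sound f ρ (decidable-stable (⟦ f ⟧? ρ) (λ f-fails → h (⊥-elim ∘ f-fails))) ,
  deny-sound g ρ (λ g-holds → h (λ _ → g-holds))
deny-sound :⊥ ρ h = leq-sound (con 0) (con 0) ρ z≤n

-- A tableau in continuation-passing style; a branch is closed before it is
-- split further whenever its atoms are already inconsistent.
tableau : NNF k → (List (Ineq k) → Bool) → List (Ineq k) → Bool
tableau (atom c)     close cs = close (c ∷ cs)
tableau (both f g)   close cs = tableau f (tableau g close) cs
tableau (either f g) close cs = refute cs ∨ (tableau f close cs ∧ tableau g close cs)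

Closes : Vec ℕ k → (List (Ineq k) → Bool) → Set
Closes ρ close = ∀ cs → T (close cs) → All (Holds ρ) cs → ⊥

tableau-sound : ∀ (f : NNF k) ρ {close} → HoldsNNF ρ f → Closes ρ close → Closes ρ (tableau f close)
tableau-sound (atom c) ρ h k cs t hs = k (c ∷ cs) t (h ∷ hs)
tableau-sound (both f g) ρ (h , h′) k = tableau-sound f ρ h (tableau-sound g ρ h′ k)
tableau-sound (either f g) ρ {close} h k cs t hs with Equivalence.to (T-∨ {refute cs}) t
... | inj₁ t′ = refute-sound cs t′ ρ hs
... | inj₂ t′ with h | Equivalence.to (T-∧ {tableau f close cs}) t′
...   | inj₁ h′ | t″ , _  = tableau-sound f ρ h′ k cs t″ hs
...   | inj₂ h′ | _  , t″ = tableau-sound g ρ h′ k cs t″ hs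

valid : Formula k → Bool
valid f = tableau (deny f) refute []

valid-sound : ∀ (f : Formula k) → T (valid f) → ∀ ρ → ⟦ f ⟧ ρ
valid-sound f t ρ = decidable-stable (⟦ f ⟧? ρ)
  (λ f-fails → tableau-sound (deny f) ρ (deny-sound f ρ f-fails) (λ cs t′ → refute-sound cs t′ ρ) [] t [])

curry-∀ⁿ : ∀ k {P : Vec ℕ k → Set} → (∀ ρ → P ρ) → ∀ⁿ k (curryⁿ P)
curry-∀ⁿ zero    h   = h []
curry-∀ⁿ (suc k) h x = curry-∀ⁿ k (λ ρ → h (x ∷ ρ))

-- Abstract so that with-abstraction does not unfold the proofs it produces.
abstract
  arith : ∀ k (f : N-ary k (Expr k) (Formula k)) → let φ = f $ⁿ Vec.map var (allFin k) in
          {T (valid φ)} → ∀ⁿ k (curryⁿ ⟦ φ ⟧)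
  arith k f {t} = curry-∀ⁿ k (valid-sound _ t)

-- Cyclic order

In Out : ℕ → ℕ → ℕ → Set
In a b x  = (a < x × x < b) ⊎ (b < x × x < a)
Out a b x = (x < a × x < b) ⊎ (a < x × b < x)

Cross : ℕ → ℕ → ℕ → ℕ → Set
Cross a b c d = (In a b c × Out a b d) ⊎ (Out a b c × In a b d)

Window : ℕ → ℕ → ℕ → Set
Window n i v = (i ≤ v × v < i + n) ⊎ (v + 2 * n < i + n)

-- Syntactic copies of the predicates on labels. Their meaning under `⟦_⟧` unfolds to `In`, `Out`,
-- `Cross`, `Window`, and `Crosses` and `InWindow` unfold to the latter two at `toℕ`, so results of
-- `arith` apply to points without conversion.
module _ {k : ℕ} where
  :¬_ : Formula k → Formula k
  :¬ f = f :⇒ :⊥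

  :In :Out : Expr k → Expr k → Expr k → Formula k
  :In a b x  = a :< x :∧ x :< b :∨ b :< x :∧ x :< a
  :Out a b x = x :< a :∧ x :< b :∨ a :< x :∧ b :< x

  :Cross : Expr k → Expr k → Expr k → Expr k → Formula k
  :Cross a b c d = :In a b c :∧ :Out a b d :∨ :Out a b c :∧ :In a b d

  :Window : Expr k → Expr k → Expr k → Formula k
  :Window n i v = i :≤ v :∧ v :< i :+ n :∨ v :+ 2 :* n :< i :+ n

  :Lift : Expr k → Expr k → Expr k → Expr k → Formula k
  :Lift n b x y = b :≤ x :∧ y :≡ x :∨ x :< b :∧ y :≡ x :+ 2 :* n

Cross-sym : ∀ a b c d → Cross a b c d → Cross c d a b
Cross-sym = arith 4 (λ a b c d → :Cross a b c d :⇒ :Cross c d a b)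

Cross-swapˡ : ∀ a b c d → Cross a b c d → Cross b a c d
Cross-swapˡ = arith 4 (λ a b c d → :Cross a b c d :⇒ :Cross b a c d)

-- Only one pairing of four points on a circle consists of the two diagonals. Hence if one
-- reconnection of a quadrilateral crosses, the other does not.
Cross-exclusive : ∀ a b c d → Cross a b c d → ¬ Cross a d c b
Cross-exclusive = arith 4 (λ a b c d → :Cross a b c d :⇒ :¬ :Cross a d c b)

-- Cutting the circle just before b: the labels of the points in
-- counterclockwise order from b, those below b being raised by 2n.
lift : ℕ → ℕ → ℕ → ℕ
lift n b x with b ≤? x
... | yes _ = x
... | no  _ = x + 2 * n

-- The graph of `lift`, as a disjunction of linear conditions that `arith` can split.
Lift : ℕ → ℕ → ℕ → ℕ → Set
Lift n b x y = (b ≤ x × y ≡ x) ⊎ (x < b × y ≡ x + 2 * n)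

lift-spec : ∀ n b x → Lift n b x (lift n b x)
lift-spec n b x with b ≤? x
... | yes b≤x = inj₁ (b≤x , refl)
... | no  b≰x = inj₂ (≰⇒> b≰x , refl)

lift-base : ∀ n b → lift n b b ≡ b
lift-base n b with b ≤? b
... | yes _ = refl
... | no b≰b = ⊥-elim (b≰b ≤-refl)

parity-+2* : ∀ x k → parity (x + 2 * k) ≡ parity x
parity-+2* x k = trans (ℙ.+-homo-+ x (2 * k))
  (trans (cong (parity x ℙ.+_) (ℙ.*-homo-* 2 k)) (ℙ.+-identityʳ _))

module Circle (n : ℕ) (b : ℕ) where

  pos : Pt n → ℕ
  pos x = lift n b (toℕ x)

  pos-spec : ∀ x → Lift n b (toℕ x) (pos x)
  pos-spec x = lift-spec n b (toℕ x)

  pos-injective : ∀ x y → pos x ≡ pos y → x ≡ y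
  pos-injective x y eq = toℕ-injective
    -- Capital letters stand for lifted labels. They are bound, and therefore eliminated, first,
    -- because each branch of `:Lift` fixes them by an equation.
    (arith 6 (λ X Y n b x y → x :< 2 :* n :⇒ y :< 2 :* n :⇒ :Lift n b x X :⇒ :Lift n b y Y :⇒ X :≡ Y :⇒ x :≡ y)
      _ _ n b _ _ (toℕ<n x) (toℕ<n y) (pos-spec x) (pos-spec y) eq)

  pos-≥ : ∀ x → b ≤ 2 * n → b ≤ pos x
  pos-≥ x = arith 4 (λ X n b x → :Lift n b x X :⇒ b :≤ 2 :* n :⇒ b :≤ X) _ n b _ (pos-spec x)

  pos-< : ∀ x → pos x < b + 2 * n
  pos-< x = arith 4 (λ X n b x → x :< 2 :* n :⇒ :Lift n b x X :⇒ X :< b :+ 2 :* n) _ n b _ (toℕ<n x) (pos-spec x)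

  pos-parity : ∀ x → parity (pos x) ≡ parity (toℕ x)
  pos-parity x with b ≤? toℕ x
  ... | yes _ = refl
  ... | no  _ = parity-+2* (toℕ x) n

  -- Moving the cut past one end of a chord exchanges its inside with its outside, and crossing is
  -- symmetric under this exchange.
  unlift-Cross : ∀ x y z w → Cross (pos x) (pos y) (pos z) (pos w) → Crosses x y z w
  unlift-Cross x y z w =
    arith 10 (λ X Y Z W n b x y z w →
        x :< 2 :* n :⇒ y :< 2 :* n :⇒ z :< 2 :* n :⇒ w :< 2 :* n :⇒
        :Lift n b x X :⇒ :Lift n b y Y :⇒ :Lift n b z Z :⇒ :Lift n b w W :⇒
        :Cross X Y Z W :⇒ :Cross x y z w)
      _ _ _ _ n b _ _ _ _ (toℕ<n x) (toℕ<n y) (toℕ<n z) (toℕ<n w) (pos-spec x) (pos-spec y) (pos-spec z) (pos-spec w)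

  unlift-Window : ∀ i v → Window n (pos i) (pos v) → InWindow n i v
  unlift-Window i v =
    arith 6 (λ I V n b i v →
        i :< 2 :* n :⇒ v :< 2 :* n :⇒ :Lift n b i I :⇒ :Lift n b v V :⇒ :Window n I V :⇒ :Window n i v)
      _ _ n b _ _ (toℕ<n i) (toℕ<n v) (pos-spec i) (pos-spec v)

-- Edges of a non-crossing matching join even to odd points

parity-suc : ∀ x → parity (suc x) ≡ parity x ⁻¹
parity-suc zero          = refl
parity-suc (suc zero)    = refl
parity-suc (suc (suc x)) = parity-suc x

IsEven : ∀ {m} → Fin m → Set
IsEven x = parity (toℕ x) ≡ 0ℙ

lookup-extensional : ∀ {A : Set} {m} (u v : Vec A m) → (∀ i → lookup u i ≡ lookup v i) → u ≡ v
lookup-extensional u v eq = trans (sym (tabulate∘lookup u)) (trans (tabulate-cong eq) (tabulate∘lookup v))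

module Matching {m : ℕ} (p : Conf′ m) (isMatching : IsMatching p) where

  fixed-point-free : ∀ i → p ⟨ i ⟩ ≢ i
  fixed-point-free = proj₁ isMatching

  involutive : ∀ i → p ⟨ p ⟨ i ⟩ ⟩ ≡ i
  involutive = proj₁ (proj₂ isMatching)

  noncrossing : NonCrossing p
  noncrossing = proj₂ (proj₂ isMatching)

  partner-injective : ∀ {i j} → p ⟨ i ⟩ ≡ p ⟨ j ⟩ → i ≡ j
  partner-injective {i} {j} eq = trans (sym (involutive i)) (trans (cong (p ⟨_⟩) eq) (involutive j))

  Closed : ℕ → ℕ → Set
  Closed x y = ∀ z → x ≤ toℕ z → toℕ z < y → x ≤ toℕ (p ⟨ z ⟩) × toℕ (p ⟨ z ⟩) < y

  below-edge-closed : ∀ i → Closed (suc (toℕ i)) (toℕ (p ⟨ i ⟩))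
  below-edge-closed i z i<z z<pi =
    arith 4 (λ x w u v → x :< u :⇒ u :< w :⇒ :¬ (v :≡ x) :⇒ :¬ (v :≡ w) :⇒ :¬ :Cross x w u v :⇒
                         con 1 :+ x :≤ v :∧ v :< w)
      _ _ _ _ i<z z<pi
      (λ eq → <-irrefl (cong toℕ (sym (trans (cong (p ⟨_⟩) (sym (toℕ-injective eq))) (involutive z)))) z<pi)
      (λ eq → <-irrefl (cong toℕ (sym (partner-injective (toℕ-injective eq)))) i<z)
      (noncrossing i z)

  -- The partner w of the first point x splits the interval: the points strictly between x and w,
  -- and those after w, again form closed intervals, of even length by induction. The number f is
  -- fuel that bounds the length.
  closed⇒even : ∀ f x y → y ≤ x + f → x ≤ y → y ≤ m → Closed x y → ∃[ k ] y ≡ x + 2 * k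
  closed⇒even zero x y y≤x x≤y _ _ =
    0 , arith 2 (λ x y → y :≤ x :+ con 0 :⇒ x :≤ y :⇒ y :≡ x :+ con 0) x y y≤x x≤y
  closed⇒even (suc f) x y y≤ x≤y y≤m closed with x <? y
  ... | no  x≮y = 0 , arith 2 (λ x y → :¬ (x :< y) :⇒ x :≤ y :⇒ y :≡ x :+ con 0) x y x≮y x≤y
  ... | yes x<y =
    suc (proj₁ low + proj₁ high) ,
    arith 5 (λ x y w k l → w :≡ con 1 :+ x :+ 2 :* k :⇒ y :≡ con 1 :+ w :+ 2 :* l :⇒
                           y :≡ x :+ 2 :* (con 1 :+ (k :+ l)))
      x y w (proj₁ low) (proj₁ high) (proj₂ low) (proj₂ high)
    where
    z = fromℕ< (<-≤-trans x<y y≤m)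
    w = toℕ (p ⟨ z ⟩)
    z≡x : toℕ z ≡ x
    z≡x = toℕ-fromℕ< _
    within = closed z (≤-reflexive (sym z≡x)) (subst (_< y) (sym z≡x) x<y)
    w<y : w < y
    w<y = proj₂ within
    x<w : x < w
    x<w = ≤∧≢⇒< (proj₁ within) (λ eq → fixed-point-free z (toℕ-injective (trans (sym eq) (sym z≡x))))
    inner : Closed (suc x) w
    inner = subst (λ x → Closed (suc x) w) z≡x (below-edge-closed z)
    outer : Closed (suc w) y
    outer u w<u u<y =
      arith 5 (λ x w y u v → w :< u :⇒ x :≤ v :∧ v :< y :⇒ :¬ (v :≡ x) :⇒ :¬ (v :≡ w) :⇒
                 (x :< v :⇒ v :< w :⇒ x :< u :∧ u :< w) :⇒ con 1 :+ w :≤ v :∧ v :< y)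
        x w y (toℕ u) (toℕ (p ⟨ u ⟩)) w<u (closed u (<⇒≤ (<-trans x<w w<u)) u<y)
        (λ eq → <-irrefl (cong toℕ (trans (cong (p ⟨_⟩) (sym (toℕ-injective (trans eq (sym z≡x))))) (involutive u))) w<u)
        (λ eq → <-asym x<w (subst (w <_) (trans (cong toℕ (partner-injective (toℕ-injective eq))) z≡x) w<u))
        (λ x<v v<w → subst (λ u → x < toℕ u × toℕ u < w) (involutive u) (inner (p ⟨ u ⟩) x<v v<w))
    w≤ : w ≤ suc x + f
    w≤ = arith 4 (λ x y w f → y :≤ x :+ (con 1 :+ f) :⇒ w :< y :⇒ w :≤ con 1 :+ x :+ f) x y w f y≤ w<y
    y≤′ : y ≤ suc w + f
    y≤′ = arith 4 (λ x y w f → y :≤ x :+ (con 1 :+ f) :⇒ x :< w :⇒ y :≤ con 1 :+ w :+ f) x y w f y≤ x<w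
    low : ∃[ k ] w ≡ suc x + 2 * k
    low = closed⇒even f (suc x) w w≤ x<w (≤-trans (<⇒≤ w<y) y≤m) inner
    high : ∃[ l ] y ≡ suc w + 2 * l
    high = closed⇒even f (suc w) y y≤′ w<y y≤m outer

  private
    flips-parity : ∀ i → toℕ i < toℕ (p ⟨ i ⟩) → parity (toℕ (p ⟨ i ⟩)) ≡ parity (toℕ i) ⁻¹
    flips-parity i i<pi =
      trans (cong parity (proj₂ gap)) (trans (parity-+2* (suc (toℕ i)) (proj₁ gap)) (parity-suc (toℕ i)))
      where
      gap : ∃[ k ] toℕ (p ⟨ i ⟩) ≡ suc (toℕ i) + 2 * k
      gap = closed⇒even m (suc (toℕ i)) (toℕ (p ⟨ i ⟩))
        (≤-trans (<⇒≤ (toℕ<n _)) (m≤n+m m (suc (toℕ i)))) i<pi (<⇒≤ (toℕ<n _)) (below-edge-closed i)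

  partner-parity : ∀ i → parity (toℕ (p ⟨ i ⟩)) ≡ parity (toℕ i) ⁻¹
  partner-parity i with <-cmp (toℕ i) (toℕ (p ⟨ i ⟩))
  ... | tri< i<pi _ _ = flips-parity i i<pi
  ... | tri≈ _ eq _   = ⊥-elim (fixed-point-free i (sym (toℕ-injective eq)))
  ... | tri> _ _ pi<i = trans (sym (ℙ.⁻¹-involutive _)) (cong _⁻¹ (sym
    (subst (λ j → parity (toℕ j) ≡ parity (toℕ (p ⟨ i ⟩)) ⁻¹) (involutive i)
      (flips-parity (p ⟨ i ⟩) (subst (λ j → toℕ (p ⟨ i ⟩) < toℕ j) (sym (involutive i)) pi<i)))))

  even⇒partner-odd : ∀ {i} → IsEven i → parity (toℕ (p ⟨ i ⟩)) ≡ 1ℙ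
  even⇒partner-odd {i} even = trans (partner-parity i) (cong _⁻¹ even)

  infix 4 _~_
  _~_ : Fin m → Fin m → Set
  a ~ b = a ≡ b ⊎ a ≡ p ⟨ b ⟩

  ~-sym : ∀ {a b} → a ~ b → b ~ a
  ~-sym (inj₁ refl) = inj₁ refl
  ~-sym (inj₂ refl) = inj₂ (sym (involutive _))

  ~-trans : ∀ {a b c} → a ~ b → b ~ c → a ~ c
  ~-trans (inj₁ refl) b~c         = b~c
  ~-trans (inj₂ refl) (inj₁ refl) = inj₂ refl
  ~-trans (inj₂ refl) (inj₂ refl) = inj₁ (involutive _)

  even-~⇒≡ : ∀ {a b} → IsEven a → IsEven b → a ~ b → a ≡ b
  even-~⇒≡ _      _      (inj₁ eq)   = eq
  even-~⇒≡ even-a even-b (inj₂ refl) with trans (sym even-a) (even⇒partner-odd even-b)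
  ... | ()

  even-end : ∀ a → ∃[ e ] IsEven e × e ~ a
  even-end a with parity (toℕ a) in eq
  ... | 0ℙ = a , eq , inj₁ refl
  ... | 1ℙ = p ⟨ a ⟩ , trans (partner-parity a) (cong _⁻¹ eq) , inj₂ refl

  Vertex : Fin m → Fin m → Fin m → Set
  Vertex a c v = v ~ a ⊎ v ~ c

  vertex? : ∀ a c v → Dec (Vertex a c v)
  vertex? a c v = (v Fin.≟ a ⊎-dec v Fin.≟ p ⟨ a ⟩) ⊎-dec (v Fin.≟ c ⊎-dec v Fin.≟ p ⟨ c ⟩)

-- Centred flips and the edge facing a vertex

module _ {k : ℕ} where
  :Fits : (n i a b c d : Expr k) → Formula k
  :Fits n i a b c d = :Window n i a :∧ :Window n i b :∧ :Window n i c :∧ :Window n i d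

Fits : (n i a b c d : ℕ) → Set
Fits n i a b c d = Window n i a × Window n i b × Window n i c × Window n i d

-- Of the six orders of b, c, d seen from a, two make ab cross cd and two make ad cross cb. The
-- remaining two place c opposite a.
cyclic-orders : ∀ a b c d → a < b → a < c → a < d → b ≢ c → b ≢ d → c ≢ d →
                ¬ Cross a b c d → ¬ Cross a d c b → (b < c × c < d) ⊎ (d < c × c < b)
cyclic-orders = arith 4 (λ a b c d → a :< b :⇒ a :< c :⇒ a :< d :⇒ :¬ (b :≡ c) :⇒ :¬ (b :≡ d) :⇒ :¬ (c :≡ d) :⇒
  :¬ :Cross a b c d :⇒ :¬ :Cross a d c b :⇒ b :< c :∧ c :< d :∨ d :< c :∧ c :< b)

-- Windows that start at a vertex suffice: if an arc between consecutive vertices were longer than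
-- n, all four vertices would lie in the window starting at the end of that arc.
arcs-≤-half : ∀ a b c d n → a < b → b < c → c < d → d < a + 2 * n →
              ¬ Fits n a a b c d → ¬ Fits n b a b c d → ¬ Fits n c a b c d → ¬ Fits n d a b c d →
              b ≤ a + n × c ≤ b + n × d ≤ c + n × a + n ≤ d
arcs-≤-half = arith 5 (λ a b c d n → a :< b :⇒ b :< c :⇒ c :< d :⇒ d :< a :+ 2 :* n :⇒
  :¬ :Fits n a a b c d :⇒ :¬ :Fits n b a b c d :⇒ :¬ :Fits n c a b c d :⇒ :¬ :Fits n d a b c d :⇒
  b :≤ a :+ n :∧ c :≤ b :+ n :∧ d :≤ c :+ n :∧ a :+ n :≤ d)

-- Converts positions measured from a into positions measured from c, written with sums to avoid
-- subtraction. The quadrilateral is described from a, whereas facing c is a condition measured from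
-- c.
lift-rebase : ∀ Y C Z n a c y → a < 2 * n → c < 2 * n → y < 2 * n → Lift n a y Y → Lift n a c C → Lift n c y Z →
              (Y < C × Z + C ≡ Y + 2 * n + c) ⊎ (C ≤ Y × Z + C ≡ Y + c)
lift-rebase = arith 7 (λ Y C Z n a c y → a :< 2 :* n :⇒ c :< 2 :* n :⇒ y :< 2 :* n :⇒
  :Lift n a y Y :⇒ :Lift n a c C :⇒ :Lift n c y Z :⇒
  Y :< C :∧ Z :+ C :≡ Y :+ 2 :* n :+ c :∨ C :≤ Y :∧ Z :+ C :≡ Y :+ c)

module Flips (n : ℕ) (p : Conf n) (isMatching : IsMatching p) where

  open Matching p isMatching

  -- The two flipped edges are represented by their even endpoints a and c.
  record Flip (q : Conf n) (a c : Pt n) : Set where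
    field
      even-a    : IsEven a
      even-c    : IsEven c
      a≢c       : a ≢ c
      empty     : ∀ g v w → ¬ Vertex a c g → Vertex a c v → Vertex a c w → ¬ Crosses g (p ⟨ g ⟩) v w
      centred   : ∀ i → ¬ (∀ v → Vertex a c v → InWindow n i v)
      at-a      : q ⟨ a ⟩ ≡ p ⟨ c ⟩
      at-c      : q ⟨ c ⟩ ≡ p ⟨ a ⟩
      elsewhere : ∀ x → ¬ Vertex a c x → q ⟨ x ⟩ ≡ p ⟨ x ⟩

  flip-swap : ∀ {q a c} → Flip q a c → Flip q c a
  flip-swap φ = record
    { even-a    = φ.even-c
    ; even-c    = φ.even-a
    ; a≢c       = φ.a≢c ∘ sym
    ; empty     = λ g v w ¬g v∈ w∈ → φ.empty g v w (¬g ∘ Sum.swap) (Sum.swap v∈) (Sum.swap w∈)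
    ; centred   = λ i fits → φ.centred i (λ v v∈ → fits v (Sum.swap v∈))
    ; at-a      = φ.at-c
    ; at-c      = φ.at-a
    ; elsewhere = λ x ¬x → φ.elsewhere x (¬x ∘ Sum.swap)
    }
    where module φ = Flip φ

  -- All conditions depend on the two edges only, so they carry over to the even ends. Of the two
  -- pairings that `FlipOf` admits, parity in the matching q leaves the one joining each even end to
  -- the odd end of the other edge.
  centred⇒flip : ∀ {q a c e f} → IsMatching q → DistinctEdges p a c → EmptyQuad p a c →
                 ContainsCentre n a (p ⟨ a ⟩) c (p ⟨ c ⟩) → FlipOf p a c q →
                 IsEven e → e ~ a → IsEven f → f ~ c → Flip q e f
  centred⇒flip {q} {a} {c} {e} {f} isMatching-q (c≢a , c≢pa) empty centre (off , pairing) even-e e~a even-f f~c = record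
    { even-a    = even-e
    ; even-c    = even-f
    ; a≢c       = λ { refl → distinct (~-trans (~-sym f~c) e~a) }
    ; empty     = λ g v w ¬g v∈ w∈ crosses → empty g (off-edges g ¬g) (meets g v w (to-ac v∈) (to-ac w∈) crosses)
    ; centred   = λ i fits → centre (i , fits a (to-ef (inj₁ (inj₁ refl))) , fits _ (to-ef (inj₁ (inj₂ refl)))
                                       , fits c (to-ef (inj₂ (inj₁ refl))) , fits _ (to-ef (inj₂ (inj₂ refl))))
    ; at-a      = odd-end even-f (even⇒q-odd even-e) (~-trans (a-to-c e~a) (~-sym f~c))
    ; at-c      = odd-end even-e (even⇒q-odd even-f) (~-trans (c-to-a f~c) (~-sym e~a))
    ; elsewhere = λ x ¬x → off x (off-edges x ¬x)
    }
    where
    open Matching q isMatching-q using () renaming (even⇒partner-odd to even⇒q-odd)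

    distinct : ¬ c ~ a
    distinct (inj₁ eq) = c≢a eq
    distinct (inj₂ eq) = c≢pa eq

    to-ac : ∀ {v} → Vertex e f v → Vertex a c v
    to-ac = Sum.map (λ v~e → ~-trans v~e e~a) (λ v~f → ~-trans v~f f~c)

    to-ef : ∀ {v} → Vertex a c v → Vertex e f v
    to-ef = Sum.map (λ v~a → ~-trans v~a (~-sym e~a)) (λ v~c → ~-trans v~c (~-sym f~c))

    off-edges : ∀ x → ¬ Vertex e f x → OffEdges p a c x
    off-edges x ¬x = ¬x ∘ to-ef ∘ inj₁ ∘ inj₁ , ¬x ∘ to-ef ∘ inj₁ ∘ inj₂
                   , ¬x ∘ to-ef ∘ inj₂ ∘ inj₁ , ¬x ∘ to-ef ∘ inj₂ ∘ inj₂

    some : ∀ (P : Pt n → Set) {v} → Vertex a c v → P v → P a ⊎ P (p ⟨ a ⟩) ⊎ P c ⊎ P (p ⟨ c ⟩)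
    some P (inj₁ (inj₁ refl)) h = inj₁ h
    some P (inj₁ (inj₂ refl)) h = inj₂ (inj₁ h)
    some P (inj₂ (inj₁ refl)) h = inj₂ (inj₂ (inj₁ h))
    some P (inj₂ (inj₂ refl)) h = inj₂ (inj₂ (inj₂ h))

    meets : ∀ g v w → Vertex a c v → Vertex a c w → Crosses g (p ⟨ g ⟩) v w →
            MeetsQuad g (p ⟨ g ⟩) a (p ⟨ a ⟩) c (p ⟨ c ⟩)
    meets g v w v∈ w∈ (inj₁ (v-in , w-out)) = some (Inside g (p ⟨ g ⟩)) v∈ v-in , some (Outside g (p ⟨ g ⟩)) w∈ w-out
    meets g v w v∈ w∈ (inj₂ (v-out , w-in)) = some (Inside g (p ⟨ g ⟩)) w∈ w-in , some (Outside g (p ⟨ g ⟩)) v∈ v-out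

    a-to-c : ∀ {v} → v ~ a → q ⟨ v ⟩ ~ c
    a-to-c (inj₁ refl) = Sum.map proj₁ proj₁ pairing
    a-to-c (inj₂ refl) = Sum.swap (Sum.map (proj₁ ∘ proj₂ ∘ proj₂) (proj₁ ∘ proj₂ ∘ proj₂) pairing)

    c-to-a : ∀ {v} → v ~ c → q ⟨ v ⟩ ~ a
    c-to-a (inj₁ refl) = Sum.map (proj₁ ∘ proj₂) (proj₁ ∘ proj₂ ∘ proj₂ ∘ proj₂) pairing
    c-to-a (inj₂ refl) = Sum.swap (Sum.map (proj₁ ∘ proj₂ ∘ proj₂ ∘ proj₂) (proj₁ ∘ proj₂) pairing)

    odd-end : ∀ {u v} → IsEven v → parity (toℕ u) ≡ 1ℙ → u ~ v → u ≡ p ⟨ v ⟩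
    odd-end even-v odd-u (inj₁ refl) = case trans (sym even-v) odd-u of λ ()
    odd-end even-v odd-u (inj₂ eq)   = eq

  neighbour⇒flip : ∀ {q} → Neighbour n p q → ∃[ a ] ∃[ c ] Flip q a c
  neighbour⇒flip (isMatching-q , a , c , distinct , empty , centre , flipOf) with even-end a | even-end c
  ... | e , even-e , e~a | f , even-f , f~c =
    e , f , centred⇒flip isMatching-q distinct empty centre flipOf even-e e~a even-f f~c

  flip-determined : ∀ {q q′ a c} → IsMatching q → IsMatching q′ → Flip q a c → Flip q′ a c → q ≡ q′
  flip-determined {q} {q′} {a} {c} isMatching-q isMatching-q′ φ φ′ = lookup-extensional q q′ agree
    where
    module φ  = Flip φ
    module φ′ = Flip φ′
    module q  = Matching q isMatching-q
    module q′ = Matching q′ isMatching-q′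

    agree : ∀ x → q ⟨ x ⟩ ≡ q′ ⟨ x ⟩
    agree x with vertex? a c x
    ... | no  ¬x                 = trans (φ.elsewhere x ¬x) (sym (φ′.elsewhere x ¬x))
    ... | yes (inj₁ (inj₁ refl)) = trans φ.at-a (sym φ′.at-a)
    ... | yes (inj₂ (inj₁ refl)) = trans φ.at-c (sym φ′.at-c)
    -- This vertex is the partner of c in q, so q sends it back to c; likewise in q′.
    ... | yes (inj₁ (inj₂ refl)) = trans (trans (cong (q ⟨_⟩) (sym φ.at-c)) (q.involutive c))
                                         (sym (trans (cong (q′ ⟨_⟩) (sym φ′.at-c)) (q′.involutive c)))
    ... | yes (inj₂ (inj₂ refl)) = trans (trans (cong (q ⟨_⟩) (sym φ.at-a)) (q.involutive a))
                                         (sym (trans (cong (q′ ⟨_⟩) (sym φ′.at-a)) (q′.involutive a)))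

  -- The edge of c separates a from the antipode of a (weakly at the antipode),
  -- and the antipode lies on its short side.
  Facing : Pt n → Pt n → Set
  Facing a c = ∃[ s ] s ~ c × pos s ≤ toℕ a + n × toℕ a + n ≤ pos (p ⟨ s ⟩) × pos (p ⟨ s ⟩) ≤ pos s + n
    where open Circle n (toℕ a)

  -- In the order a, b, c, d the edge of c faces a if C ≤ A + n, and otherwise the edge of a faces
  -- c; in the order a, d, c, b the two cases are exchanged. The bounds of `arcs-≤-half` supply all
  -- the other inequalities, including the one for the short side.
  flip⇒facing : ∀ {q a c} → IsMatching q → Flip q a c → Facing a c ⊎ Facing c a
  flip⇒facing {q} {a} {c} isMatching-q φ = Sum.[ first , second ]′ (cyclic-orders A B C D
      (above b (fixed-point-free a)) (above c (φ.a≢c ∘ sym)) (above d d≢a)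
      (λ eq → c≢b (sym (pos-injective b c eq))) (λ eq → φ.a≢c (partner-injective (pos-injective b d eq)))
      (λ eq → fixed-point-free c (sym (pos-injective c d eq)))
      (λ crosses → noncrossing a c (unlift b c d crosses))
      (λ crosses → q-noncrossing a c (subst₂ (λ x y → Crosses a x c y) (sym φ.at-a) (sym φ.at-c) (unlift d c b crosses))))
    where
    module φ = Flip φ
    open Matching q isMatching-q using () renaming (noncrossing to q-noncrossing)
    open Circle n (toℕ a)
    open Circle n (toℕ c) using () renaming (pos to posᶜ; pos-spec to posᶜ-spec)
    b = p ⟨ a ⟩
    d = p ⟨ c ⟩
    A = toℕ a
    B = pos b
    C = pos c
    D = pos d

    c≢b : c ≢ b
    c≢b eq = φ.a≢c (sym (even-~⇒≡ φ.even-c φ.even-a (inj₂ eq)))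

    d≢a : d ≢ a
    d≢a eq = c≢b (trans (sym (involutive c)) (cong (p ⟨_⟩) eq))

    pos-a : pos a ≡ A
    pos-a = lift-base n A

    above : ∀ x → x ≢ a → A < pos x
    above x x≢a = ≤∧≢⇒< (pos-≥ x (<⇒≤ (toℕ<n a))) (λ eq → x≢a (pos-injective x a (trans (sym eq) (sym pos-a))))

    unlift : ∀ x y z → Cross A (pos x) (pos y) (pos z) → Crosses a x y z
    unlift x y z = unlift-Cross a x y z ∘ subst (λ A → Cross A (pos x) (pos y) (pos z)) (sym pos-a)

    not-in-window : ∀ i → ¬ Fits n (pos i) A B C D
    not-in-window i (wa , wb , wc , wd) = φ.centred i λ where
      v (inj₁ (inj₁ refl)) → unlift-Window i a (subst (Window n (pos i)) (sym pos-a) wa)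
      v (inj₁ (inj₂ refl)) → unlift-Window i b wb
      v (inj₂ (inj₁ refl)) → unlift-Window i c wc
      v (inj₂ (inj₂ refl)) → unlift-Window i d wd

    not-in-window-a : ¬ Fits n A A B C D
    not-in-window-a = subst (λ I → ¬ Fits n I A B C D) pos-a (not-in-window a)

    reorder : ∀ {i} → Fits n i A D C B → Fits n i A B C D
    reorder (wa , wd , wc , wb) = wa , wb , wc , wd

    rebase : ∀ y → (pos y < C × posᶜ y + C ≡ pos y + 2 * n + toℕ c) ⊎ (C ≤ pos y × posᶜ y + C ≡ pos y + toℕ c)
    rebase y = lift-rebase (pos y) C (posᶜ y) n A (toℕ c) (toℕ y) (toℕ<n a) (toℕ<n c) (toℕ<n y)
                 (pos-spec y) (pos-spec c) (posᶜ-spec y)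

    rebase-a : (A < C × posᶜ a + C ≡ A + 2 * n + toℕ c) ⊎ (C ≤ A × posᶜ a + C ≡ A + toℕ c)
    rebase-a = subst (λ A → (A < C × posᶜ a + C ≡ A + 2 * n + toℕ c) ⊎ (C ≤ A × posᶜ a + C ≡ A + toℕ c)) pos-a (rebase a)

    first : B < C × C < D → Facing a c ⊎ Facing c a
    first (B<C , C<D) = Sum.map (λ bounds → c , inj₁ refl , bounds) (λ bounds → a , inj₁ refl , bounds)
      (arith 8 (λ X Y A B C D n c → B :< C :∧ C :< D :⇒ A :< B :⇒
         B :≤ A :+ n :∧ C :≤ B :+ n :∧ D :≤ C :+ n :∧ A :+ n :≤ D :⇒
         A :< C :∧ X :+ C :≡ A :+ 2 :* n :+ c :∨ C :≤ A :∧ X :+ C :≡ A :+ c :⇒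
         B :< C :∧ Y :+ C :≡ B :+ 2 :* n :+ c :∨ C :≤ B :∧ Y :+ C :≡ B :+ c :⇒
         (C :≤ A :+ n :∧ A :+ n :≤ D :∧ D :≤ C :+ n) :∨ (X :≤ c :+ n :∧ c :+ n :≤ Y :∧ Y :≤ X :+ n))
       (posᶜ a) (posᶜ b) A B C D n (toℕ c) (B<C , C<D) (above b (fixed-point-free a))
       (arcs-≤-half A B C D n (above b (fixed-point-free a)) B<C C<D (pos-< d)
         not-in-window-a (not-in-window b) (not-in-window c) (not-in-window d))
       rebase-a (rebase b))

    second : D < C × C < B → Facing a c ⊎ Facing c a
    second (D<C , C<B) = Sum.map
      (λ bounds → d , inj₂ refl , subst (λ x → D ≤ A + n × A + n ≤ pos x × pos x ≤ D + n) (sym (involutive c)) bounds)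
      (λ bounds → b , inj₂ refl ,
        subst (λ x → posᶜ b ≤ toℕ c + n × toℕ c + n ≤ posᶜ x × posᶜ x ≤ posᶜ b + n) (sym (involutive a)) bounds)
      (arith 8 (λ X Y A B C D n c → D :< C :∧ C :< B :⇒ A :< D :⇒
         D :≤ A :+ n :∧ C :≤ D :+ n :∧ B :≤ C :+ n :∧ A :+ n :≤ B :⇒
         A :< C :∧ X :+ C :≡ A :+ 2 :* n :+ c :∨ C :≤ A :∧ X :+ C :≡ A :+ c :⇒
         B :< C :∧ Y :+ C :≡ B :+ 2 :* n :+ c :∨ C :≤ B :∧ Y :+ C :≡ B :+ c :⇒
         (D :≤ A :+ n :∧ A :+ n :≤ C :∧ C :≤ D :+ n) :∨ (Y :≤ c :+ n :∧ c :+ n :≤ X :∧ X :≤ Y :+ n))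
       (posᶜ a) (posᶜ b) A B C D n (toℕ c) (D<C , C<B) (above d d≢a)
       (arcs-≤-half A D C B n (above d d≢a) D<C C<B (pos-< b)
         (not-in-window-a ∘ reorder) (not-in-window d ∘ reorder) (not-in-window c ∘ reorder) (not-in-window b ∘ reorder))
       rebase-a (rebase b))

-- Charging flips to even points

Cross-irrefl : ∀ a b x → ¬ Cross a b x x
Cross-irrefl = arith 3 (λ a b x → :¬ :Cross a b x x)

even⇒double : ∀ x → parity x ≡ 0ℙ → ∃[ k ] x ≡ 2 * k
even⇒double zero          _    = 0 , refl
even⇒double (suc (suc x)) even with even⇒double x even
... | k , eq = suc k , trans (cong (2 +_) eq) (sym (*-suc 2 k))

lift-antipode : ∀ n x y → x < 2 * n → y < 2 * n → y ≡ x + n ⊎ x ≡ y + n → lift n x y ≡ x + n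
lift-antipode n x y x< y< antipodal =
  arith 4 (λ Y n x y → x :< 2 :* n :⇒ y :< 2 :* n :⇒ y :≡ x :+ n :∨ x :≡ y :+ n :⇒ :Lift n x y Y :⇒ Y :≡ x :+ n)
    (lift n x y) n x y x< y< antipodal (lift-spec n x y)

module Degree (n : ℕ) (p : Conf n) (isMatching : IsMatching p) where

  open Matching p isMatching
  open Flips n p isMatching

  same-edge : ∀ {a b s} → IsEven a → IsEven b → s ~ a → s ~ b → a ≡ b
  same-edge even-a even-b s~a s~b = even-~⇒≡ even-a even-b (~-trans (~-sym s~a) s~b)

  -- Otherwise the edge of s would separate s′ from a. Both are vertices of the quadrilateral of φ,
  -- which would then not be empty.
  facing-innermost : ∀ {q a c′ s s′} → Flip q a c′ → ¬ Vertex a c′ s → s′ ~ c′ → let open Circle n (toℕ a) in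
                     pos s < pos s′ → pos s′ ≤ toℕ a + n → ¬ toℕ a + n ≤ pos (p ⟨ s ⟩)
  facing-innermost {q} {a} {c′} {s} {s′} φ ¬s s′~c′ S<S′ S′≤ ≤T =
    Flip.empty φ s s′ a ¬s (inj₂ s′~c′) (inj₁ (inj₁ refl)) (unlift-Cross s (p ⟨ s ⟩) s′ a
      (arith 6 (λ S T S′ A a n → A :≡ a :⇒ a :≤ S :⇒ :¬ (S :≡ A) :⇒ :¬ (S′ :≡ T) :⇒
                  S :< S′ :⇒ S′ :≤ a :+ n :⇒ a :+ n :≤ T :⇒ :Cross S T S′ A)
        (pos s) (pos (p ⟨ s ⟩)) (pos s′) (pos a) (toℕ a) n (lift-base n (toℕ a)) (pos-≥ s (<⇒≤ (toℕ<n a)))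
        (λ eq → ¬s (inj₁ (inj₁ (pos-injective s a eq))))
        (λ eq → ¬s (inj₂ (~-trans (~-sym (inj₂ (pos-injective s′ (p ⟨ s ⟩) eq))) s′~c′)))
        S<S′ S′≤ ≤T))
    where open Circle n (toℕ a)

  facing-unique : ∀ {q q′ a c c′} → Flip q a c → Flip q′ a c′ → Facing a c → Facing a c′ → c ≡ c′
  facing-unique {q} {q′} {a} {c} {c′} φ φ′ (s , s~c , S≤ , ≤T , _) (s′ , s′~c′ , S′≤ , ≤T′ , _) with c Fin.≟ c′
  ... | yes c≡c′ = c≡c′
  ... | no  c≢c′ = ⊥-elim (case <-cmp (pos s) (pos s′) of λ where
      (tri< S<S′ _ _) → facing-innermost φ′ (outside φ φ′ c≢c′ s~c) s′~c′ S<S′ S′≤ ≤T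
      (tri≈ _ S≡S′ _) → c≢c′ (same-edge (Flip.even-c φ) (Flip.even-c φ′) s~c
                          (subst (_~ c′) (sym (pos-injective s s′ S≡S′)) s′~c′))
      (tri> _ _ S>S′) → facing-innermost φ (outside φ′ φ (c≢c′ ∘ sym) s′~c′) s~c S>S′ S≤ ≤T′)
    where
    open Circle n (toℕ a)
    outside : ∀ {q q′ c d s} → Flip q a c → Flip q′ a d → c ≢ d → s ~ c → ¬ Vertex a d s
    outside φ φ′ c≢d s~c (inj₁ s~a) = Flip.a≢c φ (same-edge (Flip.even-a φ) (Flip.even-c φ) s~a s~c)
    outside φ φ′ c≢d s~c (inj₂ s~d) = c≢d (same-edge (Flip.even-c φ) (Flip.even-c φ′) s~c s~d)

  -- No segment from a to another vertex crosses the edge of g: for the edge of a because p is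
  -- non-crossing, for the ends of the edge of c by emptiness, unless that edge is the edge of g and
  -- its ends bound the arc. So all vertices lie on the arc from g to its partner, which fits into
  -- the window starting at g.
  not-behind-short-edge : ∀ {q a c} → Flip q a c → ∀ b g → let open Circle n b in
                          pos g < pos a → pos a < pos (p ⟨ g ⟩) → ¬ pos (p ⟨ g ⟩) < pos g + n
  not-behind-short-edge {q} {a} {c} φ b g G<A A<H H<G+n = Flip.centred φ g window
    where
    open Circle n b
    G = pos g
    H = pos (p ⟨ g ⟩)

    in-arc : ∀ v → ¬ Crosses g (p ⟨ g ⟩) a v → InWindow n g v
    in-arc v ¬crosses = unlift-Window g v
      (arith 5 (λ G H A V n → G :< A :⇒ A :< H :⇒ H :< G :+ n :⇒ :¬ :Cross G H A V :⇒ :Window n G V)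
        G H (pos a) (pos v) n G<A A<H H<G+n (¬crosses ∘ unlift-Cross g (p ⟨ g ⟩) a v))

    at-end : ∀ v → pos v ≡ G ⊎ pos v ≡ H → InWindow n g v
    at-end v v≡ = unlift-Window g v
      (arith 5 (λ G H A V n → G :< A :⇒ A :< H :⇒ H :< G :+ n :⇒ V :≡ G :∨ V :≡ H :⇒ :Window n G V)
        G H (pos a) (pos v) n G<A A<H H<G+n v≡)

    g≁a : ¬ g ~ a
    g≁a (inj₁ refl) = <-irrefl refl G<A
    g≁a (inj₂ refl) = <-irrefl (cong pos (sym (involutive a))) A<H

    window : ∀ v → Vertex a c v → InWindow n g v
    window v (inj₁ (inj₁ refl)) = in-arc a
      (Cross-irrefl (toℕ g) (toℕ (p ⟨ g ⟩)) (toℕ a))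
    window v (inj₁ (inj₂ refl)) = in-arc (p ⟨ a ⟩) (noncrossing g a)
    window v (inj₂ v~c) with vertex? a c g
    ... | no  ¬g         = in-arc v (Flip.empty φ g a v ¬g (inj₁ (inj₁ refl)) (inj₂ v~c))
    ... | yes (inj₁ g~a) = ⊥-elim (g≁a g~a)
    ... | yes (inj₂ g~c) = at-end v (Sum.map (cong pos) (cong pos) (~-trans v~c (~-sym g~c)))

  -- For even n a diameter would join points of equal parity, so the facing edge is strictly shorter
  -- than a diameter. Unless a′ is one of its ends, a′ lies strictly behind it, which
  -- `not-behind-short-edge` forbids.
  facing-antipode : ∀ {q q′ a c a′ c′} → parity n ≡ 0ℙ → Flip q a c → Facing a c → Flip q′ a′ c′ →
                    lift n (toℕ a) (toℕ a′) ≡ toℕ a + n → c ≡ a′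
  facing-antipode {q} {q′} {a} {c} {a′} {c′} even-n φ (s , s~c , S≤ , ≤T , T≤) φ′ antipodal with c Fin.≟ a′
  ... | yes c≡a′ = c≡a′
  ... | no  c≢a′ = ⊥-elim (not-behind-short-edge φ′ (toℕ a) s
      (subst (pos s <_) (sym antipodal) (≤∧≢⇒< S≤ (λ eq → s≁a′ (inj₁ (pos-injective s a′ (trans eq (sym antipodal)))))))
      (subst (_< pos (p ⟨ s ⟩)) (sym antipodal)
        (≤∧≢⇒< ≤T (λ eq → s≁a′ (~-sym (inj₂ (pos-injective a′ (p ⟨ s ⟩) (trans antipodal eq)))))))
      (≤∧≢⇒< T≤ not-diameter))
    where
    open Circle n (toℕ a)
    s≁a′ : ¬ s ~ a′
    s≁a′ s~a′ = c≢a′ (same-edge (Flip.even-c φ) (Flip.even-a φ′) s~c s~a′)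

    not-diameter : pos (p ⟨ s ⟩) ≢ pos s + n
    not-diameter eq = ℙ.p≢p⁻¹ (parity (toℕ s)) (begin
      parity (toℕ s)                  ≡⟨ pos-parity s ⟨
      parity (pos s)                  ≡⟨ ℙ.+-identityʳ _ ⟨
      parity (pos s) ℙ.+ 0ℙ           ≡⟨ cong (parity (pos s) ℙ.+_) even-n ⟨
      parity (pos s) ℙ.+ parity n     ≡⟨ ℙ.+-homo-+ (pos s) n ⟨
      parity (pos s + n)              ≡⟨ cong parity eq ⟨
      parity (pos (p ⟨ s ⟩))          ≡⟨ pos-parity (p ⟨ s ⟩) ⟩
      parity (toℕ (p ⟨ s ⟩))          ≡⟨ partner-parity s ⟩
      parity (toℕ s) ⁻¹               ∎)
      where open ≡-Reasoning

  ChargedTo : Conf n → Fin n → Set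
  ChargedTo q j = ∃[ a ] ∃[ c ] Flip q a c × Facing a c × toℕ a ≡ 2 * toℕ j

  facing-flip : ∀ {q} → Neighbour n p q → ∃[ a ] ∃[ c ] Flip q a c × Facing a c
  facing-flip neighbour with neighbour⇒flip neighbour
  ... | a , c , φ with flip⇒facing (proj₁ neighbour) φ
  ...   | inj₁ facing = a , c , φ , facing
  ...   | inj₂ facing = c , a , flip-swap φ , facing

  charge : ∀ q → Neighbour n p q → ∃[ j ] ChargedTo q j
  charge q neighbour with facing-flip neighbour
  ... | a , c , φ , facing with even⇒double (toℕ a) (Flip.even-a φ)
  ...   | k , a≡2k = fromℕ< k<n , a , c , φ , facing , trans a≡2k (cong (2 *_) (sym (toℕ-fromℕ< k<n)))
    where
    k<n : k < n
    k<n = *-cancelˡ-< 2 k n (subst (_< 2 * n) a≡2k (toℕ<n a))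

  charge-injective : ∀ q q′ j → Neighbour n p q → Neighbour n p q′ → ChargedTo q j → ChargedTo q′ j → q ≡ q′
  charge-injective q q′ j ν ν′ (a , c , φ , facing , a≡) (a′ , c′ , φ′ , facing′ , a′≡)
    with refl ← toℕ-injective (trans a≡ (sym a′≡))
    with refl ← facing-unique φ φ′ facing facing′ = flip-determined (proj₁ ν) (proj₁ ν′) φ φ′

  HalfChargedTo : ∀ {h} → Conf n → Fin h → Set
  HalfChargedTo q j = ∃[ a ] ∃[ c ] Flip q a c × Facing a c × (toℕ a ≡ 2 * toℕ j ⊎ toℕ a ≡ 2 * toℕ j + n)

  halfCharge : ∀ {h} → n ≡ 2 * h → ∀ q → Neighbour n p q → ∃[ j ] HalfChargedTo {h} q j
  halfCharge {h} n≡2h q neighbour with facing-flip neighbour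
  ... | a , c , φ , facing with even⇒double (toℕ a) (Flip.even-a φ)
  ...   | k , a≡2k with k <? h
  ...     | yes k<h = fromℕ< k<h , a , c , φ , facing , inj₁ (trans a≡2k (cong (2 *_) (sym (toℕ-fromℕ< k<h))))
  ...     | no  k≮h = fromℕ< k∸h<h , a , c , φ , facing ,
    inj₂ (arith 6 (λ a k h n l j → a :≡ 2 :* k :⇒ n :≡ 2 :* h :⇒ h :+ l :≡ k :⇒ j :≡ l :⇒ a :≡ 2 :* j :+ n)
            (toℕ a) k h n (k ∸ h) (toℕ (fromℕ< k∸h<h)) a≡2k n≡2h split (toℕ-fromℕ< k∸h<h))
    where
    split : h + (k ∸ h) ≡ k
    split = m+[n∸m]≡n (≮⇒≥ k≮h)
    k∸h<h : k ∸ h < h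
    k∸h<h = arith 5 (λ a k h n l → a :≡ 2 :* k :⇒ n :≡ 2 :* h :⇒ h :+ l :≡ k :⇒ a :< 2 :* n :⇒ l :< h)
              (toℕ a) k h n (k ∸ h) a≡2k n≡2h split (toℕ<n a)

  -- A slot stands for an antipodal pair of even points. If the two flips sit at different points of
  -- the pair, `facing-antipode` used in both directions gives c = a′ and c′ = a, so they differ
  -- only in the roles of their two edges.
  halfCharge-injective : ∀ {h} → n ≡ 2 * h → ∀ q q′ (j : Fin h) → Neighbour n p q → Neighbour n p q′ →
                         HalfChargedTo q j → HalfChargedTo q′ j → q ≡ q′
  halfCharge-injective {h} n≡2h q q′ j ν ν′ (a , c , φ , facing , a≡) (a′ , c′ , φ′ , facing′ , a′≡) =
    cases a≡ a′≡
    where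
    same : toℕ a ≡ toℕ a′ → q ≡ q′
    same eq with refl ← toℕ-injective eq
            with refl ← facing-unique φ φ′ facing facing′ = flip-determined (proj₁ ν) (proj₁ ν′) φ φ′

    even-n : parity n ≡ 0ℙ
    even-n = trans (cong parity n≡2h) (parity-+2* 0 h)

    opposite : toℕ a′ ≡ toℕ a + n ⊎ toℕ a ≡ toℕ a′ + n → q ≡ q′
    opposite opp
      with refl ← facing-antipode even-n φ facing φ′ (lift-antipode n (toℕ a) (toℕ a′) (toℕ<n a) (toℕ<n a′) opp)
      with refl ← facing-antipode even-n φ′ facing′ φ (lift-antipode n (toℕ a′) (toℕ a) (toℕ<n a′) (toℕ<n a) (Sum.swap opp))
      = flip-determined (proj₁ ν) (proj₁ ν′) φ (flip-swap φ′)

    cases : toℕ a ≡ 2 * toℕ j ⊎ toℕ a ≡ 2 * toℕ j + n → toℕ a′ ≡ 2 * toℕ j ⊎ toℕ a′ ≡ 2 * toℕ j + n → q ≡ q′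
    cases (inj₁ eq) (inj₁ eq′) = same (trans eq (sym eq′))
    cases (inj₂ eq) (inj₂ eq′) = same (trans eq (sym eq′))
    cases (inj₁ eq) (inj₂ eq′) = opposite (inj₁ (trans eq′ (cong (_+ n) (sym eq))))
    cases (inj₂ eq) (inj₁ eq′) = opposite (inj₂ (trans eq (cong (_+ n) (sym eq′))))

-- Counting by injective charging

unique⇒lookup-injective : ∀ {A : Set} {xs : List A} → Unique xs → ∀ i j →
                          List.lookup xs i ≡ List.lookup xs j → i ≡ j
unique⇒lookup-injective (_ ∷ _)    Fin.zero    Fin.zero    _  = refl
unique⇒lookup-injective (x∉ ∷ _)   Fin.zero    (Fin.suc j) eq = ⊥-elim (All.lookup x∉ (∈-lookup j) eq)
unique⇒lookup-injective (x∉ ∷ _)   (Fin.suc i) Fin.zero    eq = ⊥-elim (All.lookup x∉ (∈-lookup i) (sym eq))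
unique⇒lookup-injective (_ ∷ uniq) (Fin.suc i) (Fin.suc j) eq = cong Fin.suc (unique⇒lookup-injective uniq i j eq)

-- `Charged` is a relation because an element may be charged to a slot other than the one that
-- `charged` happens to choose; `card-≡` relies on this freedom.
module Charging {A : Set} {P : A → Set} {D : ℕ} (Charged : A → Fin D → Set)
  (charged : ∀ x → P x → ∃[ j ] Charged x j)
  (injective : ∀ x y j → P x → P y → Charged x j → Charged y j → x ≡ y) where

  private
    module _ {d : ℕ} (card : HasCard P d) where
      xs = proj₁ card

      member : ∀ i → P (List.lookup xs i)
      member i = Equivalence.to (proj₁ (proj₂ (proj₂ card)) _) (∈-lookup i)

      slot : Fin (length xs) → Fin D
      slot i = proj₁ (charged _ (member i))

      slot-injective : ∀ {i j} → slot i ≡ slot j → i ≡ j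
      slot-injective {i} {j} eq = unique⇒lookup-injective (proj₁ (proj₂ card)) i j
        (injective _ _ (slot i) (member i) (member j) (proj₂ (charged _ (member i)))
          (subst (Charged _) (sym eq) (proj₂ (charged _ (member j)))))

  card-≤ : ∀ {d} → HasCard P d → d ≤ D
  card-≤ card@(_ , _ , _ , refl) = Fin.injective⇒≤ (slot-injective card)

  full⇒all-charged : HasCard P D → ∀ j → ∃[ x ] P x × Charged x j
  full⇒all-charged card@(_ , _ , _ , refl) j with Fin.any? (λ i → slot card i Fin.≟ j)
  ... | yes (i , refl) = _ , member card i , proj₂ (charged _ (member card i))
  ... | no  missed     = ⊥-elim (too-many j (λ i eq → missed (i , sym eq)) (slot-injective card))
    where
    too-many : ∀ {m} {f : Fin m → Fin m} j → (∀ i → j ≢ f i) → ¬ (∀ {i k} → f i ≡ f k → i ≡ k)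
    -- Pigeonhole: punching out the missed slot would leave an injection into a set with one element
    -- fewer.
    too-many {suc m} {f} j j≢ f-injective = 1+n≰n (Fin.injective⇒≤ {f = λ i → Fin.punchOut (j≢ i)}
      (λ {i} {k} eq → f-injective (Fin.punchOut-injective (j≢ i) (j≢ k) eq)))

  -- The list is complete because any x satisfying P is charged to some slot j, which f j already
  -- occupies, so injectivity gives x = f j.
  card-≡ : (f : Fin D → A) → (∀ j → P (f j)) → (∀ j → Charged (f j) j) →
           (∀ {i j} → f i ≡ f j → i ≡ j) → HasCard P D
  card-≡ f f∈P f-charged f-injective = List.tabulate f , tabulate⁺ f-injective , (λ x → mk⇔ to from) , length-tabulate f
    where
    to : ∀ {x} → x ∈ List.tabulate f → P x
    to x∈ with ∈-tabulate⁻ x∈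
    ... | j , refl = f∈P j
    from : ∀ {x} → P x → x ∈ List.tabulate f
    from {x} px with charged x px
    ... | j , x-charged = subst (_∈ List.tabulate f) (injective (f j) x j (f∈P j) px (f-charged j) x-charged) (∈-tabulate⁺ j)

-- Perimeter edges as edges with an empty side

count-none : ∀ m (f : Fin m → Bool) → (∀ i → ¬ T (f i)) → countFin m f ≡ 0
count-none zero    f none = refl
count-none (suc m) f none with f Fin.zero | none Fin.zero
... | true  | not-T = ⊥-elim (not-T tt)
... | false | _     = count-none m (f ∘ Fin.suc) (none ∘ Fin.suc)

count-zero⇒none : ∀ m (f : Fin m → Bool) → countFin m f ≡ 0 → ∀ i → ¬ T (f i)
count-zero⇒none (suc m) f eq i t with f Fin.zero in f₀
count-zero⇒none (suc m) f eq Fin.zero    t | false = subst T f₀ t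
count-zero⇒none (suc m) f eq (Fin.suc i) t | false = count-zero⇒none m (f ∘ Fin.suc) eq i t

<ᵇ-∧⇒ : ∀ {a b c d} → T ((a <ᵇ b) ∧ (c <ᵇ d)) → a < b × c < d
<ᵇ-∧⇒ {a} {b} {c} {d} t with Equivalence.to (T-∧ {a <ᵇ b}) t
... | t₁ , t₂ = <ᵇ⇒< a b t₁ , <ᵇ⇒< c d t₂

⇒<ᵇ-∧ : ∀ {a b c d} → a < b × c < d → T ((a <ᵇ b) ∧ (c <ᵇ d))
⇒<ᵇ-∧ {a} {b} (h₁ , h₂) = Equivalence.from (T-∧ {a <ᵇ b}) (<⇒<ᵇ h₁ , <⇒<ᵇ h₂)

module _ {m : ℕ} (a b x : Fin m) where

  insideᵇ⇒Inside : T (insideᵇ a b x) → Inside a b x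
  insideᵇ⇒Inside t = Sum.map <ᵇ-∧⇒ <ᵇ-∧⇒ (Equivalence.to (T-∨ {(toℕ a <ᵇ toℕ x) ∧ (toℕ x <ᵇ toℕ b)}) t)

  Inside⇒insideᵇ : Inside a b x → T (insideᵇ a b x)
  Inside⇒insideᵇ h = Equivalence.from (T-∨ {(toℕ a <ᵇ toℕ x) ∧ (toℕ x <ᵇ toℕ b)}) (Sum.map ⇒<ᵇ-∧ ⇒<ᵇ-∧ h)

  outsideᵇ⇒Outside : T (outsideᵇ a b x) → Outside a b x
  outsideᵇ⇒Outside t = Sum.map <ᵇ-∧⇒ <ᵇ-∧⇒ (Equivalence.to (T-∨ {(toℕ x <ᵇ toℕ a) ∧ (toℕ x <ᵇ toℕ b)}) t)

  Outside⇒outsideᵇ : Outside a b x → T (outsideᵇ a b x)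
  Outside⇒outsideᵇ h = Equivalence.from (T-∨ {(toℕ x <ᵇ toℕ a) ∧ (toℕ x <ᵇ toℕ b)}) (Sum.map ⇒<ᵇ-∧ ⇒<ᵇ-∧ h)

-- The definition of a perimeter edge counts edges on a side. This version speaks of points, the
-- form needed for crossings: a thin edge is crossed by no segment at all.
Thin : ∀ {m} → Conf′ m → Fin m → Set
Thin p a = (∀ x → ¬ Inside a (p ⟨ a ⟩) x) ⊎ (∀ x → ¬ Outside a (p ⟨ a ⟩) x)

thin⇒perimeter : ∀ n (p : Conf n) a → Thin p a → PerimeterEdge n p a
thin⇒perimeter n p a (inj₁ none) = cong (_⊓ sideCount₂ n p a)
  (count-none (2 * n) _ (λ i t → none i (insideᵇ⇒Inside a (p ⟨ a ⟩) i
    (proj₁ (Equivalence.to (T-∧ {insideᵇ a (p ⟨ a ⟩) i}) (proj₂ (Equivalence.to (T-∧ {toℕ i <ᵇ toℕ (p ⟨ i ⟩)}) t)))))))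
thin⇒perimeter n p a (inj₂ none) = trans (cong (sideCount₁ n p a ⊓_)
  (count-none (2 * n) _ (λ i t → none i (outsideᵇ⇒Outside a (p ⟨ a ⟩) i
    (proj₁ (Equivalence.to (T-∧ {outsideᵇ a (p ⟨ a ⟩) i}) (proj₂ (Equivalence.to (T-∧ {toℕ i <ᵇ toℕ (p ⟨ i ⟩)}) t))))))))
  (⊓-zeroʳ (sideCount₁ n p a))

thin-noncrossing : ∀ {m} (p : Conf′ m) g → Thin p g → ∀ x y → ¬ Crosses g (p ⟨ g ⟩) x y
thin-noncrossing p g (inj₁ none) x y (inj₁ (x-in , _))  = none x x-in
thin-noncrossing p g (inj₁ none) x y (inj₂ (_ , y-in))  = none y y-in
thin-noncrossing p g (inj₂ none) x y (inj₁ (_ , y-out)) = none y y-out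
thin-noncrossing p g (inj₂ none) x y (inj₂ (x-out , _)) = none x x-out

module Sides {m : ℕ} (p : Conf′ m) (isMatching : IsMatching p) where

  open Matching p isMatching

  Inside-partner : ∀ {a x} → Inside a (p ⟨ a ⟩) x → Inside a (p ⟨ a ⟩) (p ⟨ x ⟩)
  Inside-partner {a} {x} x-in =
    arith 4 (λ a b x y → :In a b x :⇒ :¬ :Cross a b x y :⇒ (y :≡ a :⇒ x :≡ b) :⇒ (y :≡ b :⇒ x :≡ a) :⇒ :In a b y)
      (toℕ a) (toℕ (p ⟨ a ⟩)) (toℕ x) (toℕ (p ⟨ x ⟩)) x-in (noncrossing a x)
      (λ eq → cong toℕ (trans (sym (involutive x)) (cong (p ⟨_⟩) (toℕ-injective eq))))
      (λ eq → cong toℕ (partner-injective (toℕ-injective eq)))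

  Outside-partner : ∀ {a x} → Outside a (p ⟨ a ⟩) x → Outside a (p ⟨ a ⟩) (p ⟨ x ⟩)
  Outside-partner {a} {x} x-out =
    arith 4 (λ a b x y → :Out a b x :⇒ :¬ :Cross a b x y :⇒ (y :≡ a :⇒ x :≡ b) :⇒ (y :≡ b :⇒ x :≡ a) :⇒ :Out a b y)
      (toℕ a) (toℕ (p ⟨ a ⟩)) (toℕ x) (toℕ (p ⟨ x ⟩)) x-out (noncrossing a x)
      (λ eq → cong toℕ (trans (sym (involutive x)) (cong (p ⟨_⟩) (toℕ-injective eq))))
      (λ eq → cong toℕ (partner-injective (toℕ-injective eq)))

  -- Every edge is counted at its smaller endpoint.
  smaller-end : ∀ (S : Fin m → Set) → (∀ {x} → S x → S (p ⟨ x ⟩)) → ∀ {x} → S x →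
                ∃[ i ] toℕ i < toℕ (p ⟨ i ⟩) × S i × S (p ⟨ i ⟩)
  smaller-end S closed {x} sx with <-cmp (toℕ x) (toℕ (p ⟨ x ⟩))
  ... | tri< x<px _ _ = x , x<px , sx , closed sx
  ... | tri≈ _ eq _   = ⊥-elim (fixed-point-free x (sym (toℕ-injective eq)))
  ... | tri> _ _ px<x = p ⟨ x ⟩ , subst (λ y → toℕ (p ⟨ x ⟩) < toℕ y) (sym (involutive x)) px<x , closed sx , closed (closed sx)

  thin-swap : ∀ {a} → Thin p (p ⟨ a ⟩) → Thin p a
  thin-swap {a} = subst (λ b → (∀ x → ¬ Inside (p ⟨ a ⟩) b x) ⊎ (∀ x → ¬ Outside (p ⟨ a ⟩) b x) → Thin p a)
    (sym (involutive a))
    (Sum.map (λ none x → none x ∘ Sum.swap) (λ none x → none x ∘ Sum.map Product.swap Product.swap))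

-- Since edges do not cross, a point on one side brings its whole edge with it, and that edge would
-- be counted.
perimeter⇒thin : ∀ n (p : Conf n) → IsMatching p → ∀ a → PerimeterEdge n p a → Thin p a
perimeter⇒thin n p isMatching a perimeter with ⊓-sel (sideCount₁ n p a) (sideCount₂ n p a)
... | inj₁ eq = inj₁ λ x x-in →
  let i , i<pi , i-in , pi-in = smaller-end (Inside a (p ⟨ a ⟩)) (λ {x} → Inside-partner {a} {x}) {x} x-in in
  count-zero⇒none (2 * n) _ (trans (sym eq) perimeter) i
    (Equivalence.from (T-∧ {toℕ i <ᵇ toℕ (p ⟨ i ⟩)}) (<⇒<ᵇ i<pi ,
      Equivalence.from (T-∧ {insideᵇ a (p ⟨ a ⟩) i}) (Inside⇒insideᵇ a _ i i-in , Inside⇒insideᵇ a _ (p ⟨ i ⟩) pi-in)))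
  where open Sides p isMatching
... | inj₂ eq = inj₂ λ x x-out →
  let i , i<pi , i-out , pi-out = smaller-end (Outside a (p ⟨ a ⟩)) (λ {x} → Outside-partner {a} {x}) {x} x-out in
  count-zero⇒none (2 * n) _ (trans (sym eq) perimeter) i
    (Equivalence.from (T-∧ {toℕ i <ᵇ toℕ (p ⟨ i ⟩)}) (<⇒<ᵇ i<pi ,
      Equivalence.from (T-∧ {outsideᵇ a (p ⟨ a ⟩) i}) (Outside⇒outsideᵇ a _ i i-out , Outside⇒outsideᵇ a _ (p ⟨ i ⟩) pi-out)))
  where open Sides p isMatching

-- Full degree forces perimeter edges

module Extremal (n : ℕ) (p : Conf n) (isMatching : IsMatching p) where

  open Matching p isMatching
  open Flips n p isMatching
  open Degree n p isMatching
  open Sides p isMatching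

  module _ (flip-at : ∀ z → IsEven z → ∃[ q ] ∃[ c ] Flip q z c × Facing z c) where

    private
      -- Flips are available at even points only, so z is replaced by the even end of its edge. This
      -- is why both ends are required to lie behind g.
      nothing-behind : ∀ b g z → let open Circle n b in pos (p ⟨ g ⟩) < pos g + n →
                       (∀ {e} → e ~ z → pos g < pos e × pos e < pos (p ⟨ g ⟩)) → ⊥
      nothing-behind b g z short behind with even-end z
      ... | e , even-e , e~z with flip-at e even-e | behind e~z
      ...   | q , c , φ , _ | G<E , E<H = not-behind-short-edge φ b g G<E E<H short

      -- `not-behind-short-edge` does not cover diameters. Here the edge facing the even end e has
      -- to straddle the antipode of e, which is the other end of the diameter, and so would cross
      -- the diameter.
      not-diameter : ∀ g → toℕ (p ⟨ g ⟩) ≢ toℕ g + n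
      not-diameter g diameter with even-end g
      ... | e , even-e , e~g with flip-at e even-e
      ...   | q , c , φ , s , s~c , S≤ , ≤T , _ = noncrossing e s (unlift-Cross e (p ⟨ e ⟩) s (p ⟨ s ⟩)
        (arith 6 (λ S T E F e n → E :≡ e :⇒ F :≡ e :+ n :⇒ e :≤ S :⇒ :¬ (S :≡ E) :⇒ :¬ (S :≡ F) :⇒ :¬ (T :≡ F) :⇒
                    S :≤ e :+ n :⇒ e :+ n :≤ T :⇒ :Cross E F S T)
          (pos s) (pos (p ⟨ s ⟩)) (pos e) (pos (p ⟨ e ⟩)) (toℕ e) n
          (lift-base n (toℕ e)) (lift-antipode n (toℕ e) (toℕ (p ⟨ e ⟩)) (toℕ<n e) (toℕ<n _) (opposite e~g))
          (pos-≥ s (<⇒≤ (toℕ<n e)))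
          (λ eq → s≁e (inj₁ (pos-injective s e eq)))
          (λ eq → s≁e (inj₂ (pos-injective s (p ⟨ e ⟩) eq)))
          (λ eq → s≁e (inj₁ (partner-injective (pos-injective (p ⟨ s ⟩) (p ⟨ e ⟩) eq))))
          S≤ ≤T))
        where
        open Circle n (toℕ e)
        s≁e : ¬ s ~ e
        s≁e s~e = Flip.a≢c φ (same-edge even-e (Flip.even-c φ) s~e s~c)
        opposite : ∀ {e} → e ~ g → toℕ (p ⟨ e ⟩) ≡ toℕ e + n ⊎ toℕ e ≡ toℕ (p ⟨ e ⟩) + n
        opposite (inj₁ refl) = inj₁ diameter
        opposite (inj₂ refl) = inj₂ (trans diameter (cong (λ x → toℕ x + n) (sym (involutive g))))

      nothing-inside : ∀ g → toℕ g < toℕ (p ⟨ g ⟩) → toℕ (p ⟨ g ⟩) < toℕ g + n → ∀ z → ¬ Inside g (p ⟨ g ⟩) z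
      nothing-inside g g<h h<g+n z z-in = nothing-behind (toℕ g) g z short behind
        where
        open Circle n (toℕ g)
        h = p ⟨ g ⟩
        short : pos h < pos g + n
        short = arith 5 (λ G H n g h → g :< h :⇒ h :< g :+ n :⇒ :Lift n g g G :⇒ :Lift n g h H :⇒ H :< G :+ n)
          (pos g) (pos h) n (toℕ g) (toℕ h) g<h h<g+n (pos-spec g) (pos-spec h)
        e-in : ∀ {e} → e ~ z → Inside g h e
        e-in (inj₁ refl) = z-in
        e-in (inj₂ refl) = Inside-partner {g} {z} z-in
        behind : ∀ {e} → e ~ z → pos g < pos e × pos e < pos h
        behind {e} e~z =
          arith 7 (λ G H E n g h e → g :< h :⇒ :Lift n g g G :⇒ :Lift n g h H :⇒ :Lift n g e E :⇒
                     :In g h e :⇒ G :< E :∧ E :< H)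
            (pos g) (pos h) (pos e) n (toℕ g) (toℕ h) (toℕ e) g<h (pos-spec g) (pos-spec h) (pos-spec e) (e-in e~z)

      nothing-outside : ∀ g → toℕ g < toℕ (p ⟨ g ⟩) → toℕ g + n < toℕ (p ⟨ g ⟩) → ∀ z → ¬ Outside g (p ⟨ g ⟩) z
      nothing-outside g g<h g+n<h z z-out = nothing-behind (toℕ h) h z
          (subst (λ g → pos g < pos h + n) (sym (involutive g)) short)
          (λ {e} e~z → subst (λ g → pos h < pos e × pos e < pos g) (sym (involutive g)) (behind e~z))
        where
        h = p ⟨ g ⟩
        open Circle n (toℕ h)
        short : pos g < pos h + n
        short = arith 5 (λ G H n g h → h :< 2 :* n :⇒ g :+ n :< h :⇒ g :< h :⇒ :Lift n h g G :⇒ :Lift n h h H :⇒ G :< H :+ n)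
          (pos g) (pos h) n (toℕ g) (toℕ h) (toℕ<n h) g+n<h g<h (pos-spec g) (pos-spec h)
        e-out : ∀ {e} → e ~ z → Outside g h e
        e-out (inj₁ refl) = z-out
        e-out (inj₂ refl) = Outside-partner {g} {z} z-out
        behind : ∀ {e} → e ~ z → pos h < pos e × pos e < pos g
        behind {e} e~z =
          arith 7 (λ G H E n g h e → e :< 2 :* n :⇒ h :< 2 :* n :⇒ g :< h :⇒
                     :Lift n h g G :⇒ :Lift n h h H :⇒ :Lift n h e E :⇒ :Out g h e :⇒ H :< E :∧ E :< G)
            (pos g) (pos h) (pos e) n (toℕ g) (toℕ h) (toℕ e) (toℕ<n e) (toℕ<n h) g<h
            (pos-spec g) (pos-spec h) (pos-spec e) (e-out e~z)

      ordered-thin : ∀ g → toℕ g < toℕ (p ⟨ g ⟩) → Thin p g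
      ordered-thin g g<h with <-cmp (toℕ (p ⟨ g ⟩)) (toℕ g + n)
      ... | tri< h<g+n _ _    = inj₁ (nothing-inside g g<h h<g+n)
      ... | tri≈ _ diameter _ = ⊥-elim (not-diameter g diameter)
      ... | tri> _ _ g+n<h    = inj₂ (nothing-outside g g<h g+n<h)

    flips-everywhere⇒thin : ∀ g → Thin p g
    flips-everywhere⇒thin g with <-cmp (toℕ g) (toℕ (p ⟨ g ⟩))
    ... | tri< g<h _ _ = ordered-thin g g<h
    ... | tri≈ _ eq _  = ⊥-elim (fixed-point-free g (sym (toℕ-injective eq)))
    ... | tri> _ _ h<g = thin-swap (ordered-thin (p ⟨ g ⟩) (subst (λ x → toℕ (p ⟨ g ⟩) < toℕ x) (sym (involutive g)) h<g))

  full-degree⇒perimeter : DegreeIs n p n → AllPerimeter n p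
  full-degree⇒perimeter degree g = thin⇒perimeter n p g (flips-everywhere⇒thin flip-at g)
    where
    open Charging ChargedTo charge charge-injective
    flip-at : ∀ z → IsEven z → ∃[ q ] ∃[ c ] Flip q z c × Facing z c
    flip-at z even-z = at-z (full⇒all-charged degree (fromℕ< half<n))
      where
      half = proj₁ (even⇒double (toℕ z) even-z)
      z≡2half : toℕ z ≡ 2 * half
      z≡2half = proj₂ (even⇒double (toℕ z) even-z)
      half<n : half < n
      half<n = *-cancelˡ-< 2 half n (subst (_< 2 * n) z≡2half (toℕ<n z))
      at-z : ∃[ q ] Neighbour n p q × ChargedTo q (fromℕ< half<n) → ∃[ q ] ∃[ c ] Flip q z c × Facing z c
      at-z (q , _ , a , c , φ , facing , a≡)
        with refl ← toℕ-injective {i = a} {j = z} (trans a≡ (trans (cong (2 *_) (toℕ-fromℕ< half<n)) (sym z≡2half)))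
        = q , c , φ , facing

-- Constructing flips in a matching by perimeter edges

Cross-self : ∀ a b → ¬ Cross a b a b
Cross-self = arith 2 (λ a b → :¬ :Cross a b a b)

point-at : ∀ n (b : Pt n) t → toℕ b ≤ t → t < toℕ b + 2 * n → ∃[ x ] Circle.pos n (toℕ b) x ≡ t
point-at n b t b≤t t<b+2n with t <? 2 * n
... | yes t<2n = fromℕ< t<2n ,
  arith 5 (λ X n b t x → :Lift n b x X :⇒ x :≡ t :⇒ b :≤ t :⇒ X :≡ t)
    (pos (fromℕ< t<2n)) n (toℕ b) t _ (pos-spec (fromℕ< t<2n)) (toℕ-fromℕ< t<2n) b≤t
  where open Circle n (toℕ b)
... | no t≮2n = fromℕ< u<2n ,
  arith 6 (λ X n b t x u → :Lift n b x X :⇒ x :≡ u :⇒ 2 :* n :+ u :≡ t :⇒ t :< b :+ 2 :* n :⇒ X :≡ t)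
    (pos (fromℕ< u<2n)) n (toℕ b) t _ u (pos-spec (fromℕ< u<2n)) (toℕ-fromℕ< u<2n) split t<b+2n
  where
  open Circle n (toℕ b)
  u = t ∸ 2 * n
  split : 2 * n + u ≡ t
  split = m+[n∸m]≡n (≮⇒≥ t≮2n)
  u<2n : u < 2 * n
  u<2n = arith 4 (λ n b t u → 2 :* n :+ u :≡ t :⇒ t :< b :+ 2 :* n :⇒ b :< 2 :* n :⇒ u :< 2 :* n)
    n (toℕ b) t u split t<b+2n (toℕ<n b)

module Reconnection {m : ℕ} (p : Conf′ m) (isMatching : IsMatching p) where

  open Matching p isMatching

  -- With c and with its partner as second argument this yields the two possible reconnections of
  -- the same two edges.
  reconnect : Fin m → Fin m → Conf′ m
  reconnect a c = p [ a ]≔ c [ c ]≔ a [ p ⟨ a ⟩ ]≔ p ⟨ c ⟩ [ p ⟨ c ⟩ ]≔ p ⟨ a ⟩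

  module _ (a c : Fin m) (c≁a : ¬ c ~ a) where

    private
      b = p ⟨ a ⟩
      d = p ⟨ c ⟩
      p₁ = p [ a ]≔ c
      p₂ = p₁ [ c ]≔ a
      p₃ = p₂ [ b ]≔ d
      r = reconnect a c

      a≢c : a ≢ c
      a≢c eq = c≁a (inj₁ (sym eq))
      a≢b : a ≢ b
      a≢b = fixed-point-free a ∘ sym
      a≢d : a ≢ d
      a≢d = c≁a ∘ ~-sym ∘ inj₂
      c≢b : c ≢ b
      c≢b = c≁a ∘ inj₂
      c≢d : c ≢ d
      c≢d = fixed-point-free c ∘ sym
      b≢d : b ≢ d
      b≢d = a≢c ∘ partner-injective

    reconnect-a : r ⟨ a ⟩ ≡ c
    reconnect-a = trans (lookup∘update′ a≢d p₃ b) (trans (lookup∘update′ a≢b p₂ d)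
                    (trans (lookup∘update′ a≢c p₁ a) (lookup∘update a p c)))

    reconnect-c : r ⟨ c ⟩ ≡ a
    reconnect-c = trans (lookup∘update′ c≢d p₃ b) (trans (lookup∘update′ c≢b p₂ d) (lookup∘update c p₁ a))

    reconnect-b : r ⟨ b ⟩ ≡ d
    reconnect-b = trans (lookup∘update′ b≢d p₃ b) (lookup∘update b p₂ d)

    reconnect-d : r ⟨ d ⟩ ≡ b
    reconnect-d = lookup∘update d p₃ b

    reconnect-off : ∀ x → ¬ Vertex a c x → r ⟨ x ⟩ ≡ p ⟨ x ⟩
    reconnect-off x ¬x =
      trans (lookup∘update′ (¬x ∘ inj₂ ∘ inj₂) p₃ b) (trans (lookup∘update′ (¬x ∘ inj₁ ∘ inj₂) p₂ d)
        (trans (lookup∘update′ (¬x ∘ inj₂ ∘ inj₁) p₁ a) (lookup∘update′ (¬x ∘ inj₁ ∘ inj₁) p c)))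

    reconnect-involutive : ∀ x → r ⟨ r ⟨ x ⟩ ⟩ ≡ x
    reconnect-involutive x with vertex? a c x
    ... | yes (inj₁ (inj₁ refl)) = trans (cong (r ⟨_⟩) reconnect-a) reconnect-c
    ... | yes (inj₁ (inj₂ refl)) = trans (cong (r ⟨_⟩) reconnect-b) reconnect-d
    ... | yes (inj₂ (inj₁ refl)) = trans (cong (r ⟨_⟩) reconnect-c) reconnect-a
    ... | yes (inj₂ (inj₂ refl)) = trans (cong (r ⟨_⟩) reconnect-d) reconnect-b
    ... | no ¬x = trans (cong (r ⟨_⟩) (reconnect-off x ¬x)) (trans (reconnect-off (p ⟨ x ⟩) ¬px) (involutive x))
      where
      ¬px : ¬ Vertex a c (p ⟨ x ⟩)
      ¬px = ¬x ∘ Sum.map (~-trans (~-sym (inj₂ refl))) (~-trans (~-sym (inj₂ refl)))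

    reconnect-fixed-point-free : ∀ x → r ⟨ x ⟩ ≢ x
    reconnect-fixed-point-free x eq with vertex? a c x
    ... | yes (inj₁ (inj₁ refl)) = a≢c (trans (sym eq) reconnect-a)
    ... | yes (inj₁ (inj₂ refl)) = b≢d (trans (sym eq) reconnect-b)
    ... | yes (inj₂ (inj₁ refl)) = a≢c (trans (sym reconnect-c) eq)
    ... | yes (inj₂ (inj₂ refl)) = b≢d (trans (sym reconnect-d) eq)
    ... | no ¬x = fixed-point-free x (trans (sym (reconnect-off x ¬x)) eq)

    module _ (thin : ∀ g → Thin p g) (uncrossed : ¬ Crosses a c b d) where

      private
        CrossAt : Fin m → Fin m → Set
        CrossAt i j = Crosses i (r ⟨ i ⟩) j (r ⟨ j ⟩)

        CrossAt-sym : ∀ i j → CrossAt i j → CrossAt j i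
        CrossAt-sym i j = Cross-sym (toℕ i) (toℕ (r ⟨ i ⟩)) (toℕ j) (toℕ (r ⟨ j ⟩))

        CrossAt-partner : ∀ i j → CrossAt (r ⟨ i ⟩) j → CrossAt i j
        CrossAt-partner i j h = Cross-swapˡ (toℕ (r ⟨ i ⟩)) (toℕ i) (toℕ j) (toℕ (r ⟨ j ⟩))
          (subst (λ x → Crosses (r ⟨ i ⟩) x j (r ⟨ j ⟩)) (reconnect-involutive i) h)

        CrossAt-a-b : ¬ CrossAt a b
        CrossAt-a-b h = uncrossed (subst₂ (λ x y → Crosses a x b y) reconnect-a reconnect-b h)

        representative : ∀ {i} → Vertex a c i → ∀ j → CrossAt i j → CrossAt a j ⊎ CrossAt b j
        representative (inj₁ (inj₁ refl)) j h = inj₁ h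
        representative (inj₁ (inj₂ refl)) j h = inj₂ h
        representative (inj₂ (inj₁ refl)) j h = inj₁ (CrossAt-partner a j (subst (λ x → CrossAt x j) (sym reconnect-a) h))
        representative (inj₂ (inj₂ refl)) j h = inj₂ (CrossAt-partner b j (subst (λ x → CrossAt x j) (sym reconnect-b) h))

        CrossAt-self : ∀ i → ¬ CrossAt i i
        CrossAt-self i = Cross-self (toℕ i) (toℕ (r ⟨ i ⟩))

        CrossAt-a : ∀ {j} → Vertex a c j → ¬ CrossAt a j
        CrossAt-a j∈ h = Sum.[ CrossAt-self a , CrossAt-a-b ∘ CrossAt-sym b a ]′ (representative j∈ a (CrossAt-sym a _ h))

        CrossAt-b : ∀ {j} → Vertex a c j → ¬ CrossAt b j
        CrossAt-b j∈ h = Sum.[ CrossAt-a-b , CrossAt-self b ]′ (representative j∈ b (CrossAt-sym b _ h))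

        CrossAt-off : ∀ i j → ¬ Vertex a c i → ¬ CrossAt i j
        CrossAt-off i j ¬i h = thin-noncrossing p i (thin i) j (r ⟨ j ⟩)
          (subst (λ x → Crosses i x j (r ⟨ j ⟩)) (reconnect-off i ¬i) h)

      -- Untouched edges are thin and cross nothing. A crossing of the two new edges can be moved,
      -- by symmetry and by exchanging ends, to the representatives a and b, where `uncrossed`
      -- excludes it.
      reconnect-noncrossing : NonCrossing r
      reconnect-noncrossing i j h with vertex? a c i | vertex? a c j
      ... | no ¬i  | _      = CrossAt-off i j ¬i h
      ... | yes _  | no ¬j  = CrossAt-off j i ¬j (CrossAt-sym i j h)
      ... | yes i∈ | yes j∈ = Sum.[ CrossAt-a j∈ , CrossAt-b j∈ ]′ (representative i∈ j h)

      reconnect-isMatching : IsMatching r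
      reconnect-isMatching = reconnect-fixed-point-free , reconnect-involutive , reconnect-noncrossing

module ThinNeighbours (n : ℕ) (2≤n : 2 ≤ n) (p : Conf n) (isMatching : IsMatching p) (thin : ∀ g → Thin p g) where

  open Matching p isMatching
  open Flips n p isMatching
  open Reconnection p isMatching

  -- Of the two ways to reconnect, one is non-crossing and so yields a matching;
  -- by parity it must be the one that joins even to odd points.
  parity-uncrossed : ∀ a c → IsEven a → IsEven c → a ≢ c → ¬ Crosses a (p ⟨ c ⟩) (p ⟨ a ⟩) c
  parity-uncrossed a c even-a even-c a≢c crosses =
    ℙ.p≢p⁻¹ (parity (toℕ a)) (trans even-a (trans (sym even-c)
      (trans (cong (parity ∘ toℕ) (sym (reconnect-a a c c≁a))) (r.partner-parity a))))
    where
    c≁a : ¬ c ~ a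
    c≁a = a≢c ∘ sym ∘ even-~⇒≡ even-c even-a
    uncrossed : ¬ Crosses a c (p ⟨ a ⟩) (p ⟨ c ⟩)
    uncrossed = Cross-exclusive (toℕ a) (toℕ (p ⟨ c ⟩)) (toℕ (p ⟨ a ⟩)) (toℕ c) crosses
    module r = Matching (reconnect a c) (reconnect-isMatching a c c≁a thin uncrossed)

  record OppositeFlip (a : Pt n) : Set where
    field
      q         : Conf n
      c w       : Pt n
      antipodal : Circle.pos n (toℕ a) w ≡ toℕ a + n
      w~c       : w ~ c
      neighbour : Neighbour n p q
      flip      : Flip q a c
      facing    : Facing a c

  -- The quadrilateral has both a and its antipode w among its vertices, so it contains a diameter
  -- of the circle and is centred; thinness of all edges makes it empty.
  oppositeFlip : ∀ a → IsEven a → OppositeFlip a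
  oppositeFlip a even-a = record
    { q = q ; c = c ; w = w ; antipodal = W≡ ; w~c = ~-sym c~w
    ; neighbour = isMatching-q , a , c , distinct , empty , centre , flipOf
    ; flip      = centred⇒flip isMatching-q distinct empty centre flipOf even-a (inj₁ refl) even-c (inj₁ refl)
    ; facing    = facing
    }
    where
    open Circle n (toℕ a)

    antipode = point-at n a (toℕ a + n) (m≤m+n (toℕ a) n)
                 (arith 2 (λ n a → con 2 :≤ n :⇒ a :+ n :< a :+ 2 :* n) n (toℕ a) 2≤n)
    w  = proj₁ antipode
    W≡ : pos w ≡ toℕ a + n
    W≡ = proj₂ antipode

    w≢a : w ≢ a
    w≢a eq = arith 3 (λ X n a → X :≡ a :⇒ X :≡ a :+ n :⇒ con 2 :≤ n :⇒ :⊥)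
      (pos w) n (toℕ a) (trans (cong pos eq) (lift-base n (toℕ a))) W≡ 2≤n

    -- The positions a + 1 and a + n + 1 lie on different sides of the diameter at a, as 2 ≤ n, so
    -- that diameter is not thin.
    w≢pa : w ≢ p ⟨ a ⟩
    w≢pa eq = thin-noncrossing p a (thin a) (proj₁ x) (proj₁ y) (unlift-Cross a (p ⟨ a ⟩) (proj₁ x) (proj₁ y)
      (arith 6 (λ A B X Y a n → A :≡ a :⇒ B :≡ a :+ n :⇒ X :≡ a :+ con 1 :⇒ Y :≡ a :+ (n :+ con 1) :⇒
                  con 2 :≤ n :⇒ :Cross A B X Y)
        (pos a) (pos (p ⟨ a ⟩)) (pos (proj₁ x)) (pos (proj₁ y)) (toℕ a) n
        (lift-base n (toℕ a)) (trans (cong pos (sym eq)) W≡) (proj₂ x) (proj₂ y) 2≤n))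
      where
      x = point-at n a (toℕ a + 1) (m≤m+n (toℕ a) 1)
            (arith 2 (λ n a → con 2 :≤ n :⇒ a :+ con 1 :< a :+ 2 :* n) n (toℕ a) 2≤n)
      y = point-at n a (toℕ a + (n + 1)) (m≤m+n (toℕ a) (n + 1))
            (arith 2 (λ n a → con 2 :≤ n :⇒ a :+ (n :+ con 1) :< a :+ 2 :* n) n (toℕ a) 2≤n)

    c = proj₁ (even-end w)
    even-c : IsEven c
    even-c = proj₁ (proj₂ (even-end w))
    c~w : c ~ w
    c~w = proj₂ (proj₂ (even-end w))

    c≁a : ¬ c ~ a
    c≁a c~a = Sum.[ w≢a , w≢pa ]′ (~-trans (~-sym c~w) c~a)

    pc≁a : ¬ p ⟨ c ⟩ ~ a
    pc≁a = c≁a ∘ ~-trans (~-sym (inj₂ refl))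

    a≢c : a ≢ c
    a≢c = c≁a ∘ inj₁ ∘ sym

    -- The partner of c is forced by parity: a and c are both even.
    q = reconnect a (p ⟨ c ⟩)

    uncrossed : ¬ Crosses a (p ⟨ c ⟩) (p ⟨ a ⟩) c
    uncrossed = parity-uncrossed a c even-a even-c a≢c

    isMatching-q : IsMatching q
    isMatching-q = reconnect-isMatching a (p ⟨ c ⟩) pc≁a thin
      (uncrossed ∘ subst (Crosses a (p ⟨ c ⟩) (p ⟨ a ⟩)) (involutive c))

    distinct : DistinctEdges p a c
    distinct = c≁a ∘ inj₁ , c≁a ∘ inj₂

    empty : EmptyQuad p a c
    empty g _ (ins , outs) with thin g
    ... | inj₁ none = Sum.[ none a , Sum.[ none _ , Sum.[ none c , none _ ]′ ]′ ]′ ins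
    ... | inj₂ none = Sum.[ none a , Sum.[ none _ , Sum.[ none c , none _ ]′ ]′ ]′ outs

    not-both : ∀ i → InWindow n i a → ¬ InWindow n i w
    not-both i = arith 5 (λ W n a w i → W :≡ a :+ n :⇒ :Lift n a w W :⇒ a :< 2 :* n :⇒ w :< 2 :* n :⇒ i :< 2 :* n :⇒
                            :Window n i a :⇒ :¬ :Window n i w)
      (pos w) n (toℕ a) (toℕ w) (toℕ i) W≡ (pos-spec w) (toℕ<n a) (toℕ<n w) (toℕ<n i)

    centre : ContainsCentre n a (p ⟨ a ⟩) c (p ⟨ c ⟩)
    centre (i , wa , _ , wc , wd) = not-both i wa
      (Sum.[ (λ eq → subst (InWindow n i) (sym eq) wc) , (λ eq → subst (InWindow n i) (sym eq) wd) ]′ (~-sym c~w))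

    flipOf : FlipOf p a c q
    flipOf = (λ x (x≢a , x≢pa , x≢c , x≢pc) → reconnect-off a (p ⟨ c ⟩) pc≁a x λ where
                 (inj₁ (inj₁ eq)) → x≢a eq
                 (inj₁ (inj₂ eq)) → x≢pa eq
                 (inj₂ (inj₁ eq)) → x≢pc eq
                 (inj₂ (inj₂ eq)) → x≢c (trans eq (involutive c)))
           , inj₂ (reconnect-a a (p ⟨ c ⟩) pc≁a , reconnect-c a (p ⟨ c ⟩) pc≁a
                  , trans (reconnect-b a (p ⟨ c ⟩) pc≁a) (involutive c)
                  , trans (cong (q ⟨_⟩) (sym (involutive c))) (reconnect-d a (p ⟨ c ⟩) pc≁a)
                  , uncrossed)

    facing : Facing a c
    -- The antipode w is itself an end of the edge. The witness s has to be whichever end comes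
    -- first when counting from a.
    facing with ≤-total (pos w) (pos (p ⟨ w ⟩))
    ... | inj₁ W≤ = w , ~-sym c~w ,
      arith 4 (λ W V a n → W :≡ a :+ n :⇒ W :≤ V :⇒ V :< a :+ 2 :* n :⇒ W :≤ a :+ n :∧ a :+ n :≤ V :∧ V :≤ W :+ n)
        (pos w) (pos (p ⟨ w ⟩)) (toℕ a) n W≡ W≤ (pos-< (p ⟨ w ⟩))
    ... | inj₂ V≤W = p ⟨ w ⟩ , ~-trans (inj₂ refl) (~-sym c~w) ,
      subst (λ x → pos (p ⟨ w ⟩) ≤ toℕ a + n × toℕ a + n ≤ pos x × pos x ≤ pos (p ⟨ w ⟩) + n) (sym (involutive w))
        (arith 4 (λ W V a n → W :≡ a :+ n :⇒ V :≤ W :⇒ a :≤ V :⇒ V :≤ a :+ n :∧ a :+ n :≤ W :∧ W :≤ V :+ n)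
          (pos w) (pos (p ⟨ w ⟩)) (toℕ a) n W≡ V≤W (pos-≥ (p ⟨ w ⟩) (<⇒≤ (toℕ<n a))))

-- Degrees of matchings by perimeter edges

module ThinDegree (n : ℕ) (2≤n : 2 ≤ n) (p : Conf n) (isMatching : IsMatching p) (thin : ∀ g → Thin p g) where

  open Matching p isMatching
  open Flips n p isMatching
  open Degree n p isMatching
  open ThinNeighbours n 2≤n p isMatching thin

  -- Seen as a flip at a′, q joins a′ to the partner of c′ and so changes the partner of a′. Only
  -- vertices of the first quadrilateral are changed.
  flip-vertex : ∀ {q a c a′ c′} → Flip q a c → Flip q a′ c′ → Vertex a c a′
  flip-vertex {a = a} {c} {a′} φ φ′ with vertex? a c a′
  ... | yes a′∈ = a′∈
  ... | no  a′∉ = ⊥-elim (Flip.a≢c φ′ (partner-injective (trans (sym (Flip.elsewhere φ a′ a′∉)) (Flip.at-a φ′))))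

  double : (j : ℕ) → j < n → Pt n
  double j j<n = fromℕ< (*-monoʳ-< 2 j<n)

  toℕ-double : ∀ j j<n → toℕ (double j j<n) ≡ 2 * j
  toℕ-double j j<n = toℕ-fromℕ< _

  double-even : ∀ j j<n → IsEven (double j j<n)
  double-even j j<n = trans (cong parity (toℕ-double j j<n)) (parity-+2* 0 j)

  double-injective : ∀ i j i<n j<n → double i i<n ≡ double j j<n → i ≡ j
  double-injective i j i<n j<n eq = *-cancelˡ-≡ i j 2
    (trans (sym (toℕ-double i i<n)) (trans (cong toℕ eq) (toℕ-double j j<n)))

  flip-at : ∀ j (j<n : j < n) → OppositeFlip (double j j<n)
  flip-at j j<n = oppositeFlip (double j j<n) (double-even j j<n)

  antipode-parity : ∀ {a} (o : OppositeFlip a) → IsEven a → parity (toℕ (OppositeFlip.w o)) ≡ parity n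
  antipode-parity {a} o even-a = begin
    parity (toℕ o.w)              ≡⟨ pos-parity o.w ⟨
    parity (pos o.w)              ≡⟨ cong parity o.antipodal ⟩
    parity (toℕ a + n)            ≡⟨ ℙ.+-homo-+ (toℕ a) n ⟩
    parity (toℕ a) ℙ.+ parity n   ≡⟨ cong (ℙ._+ parity n) even-a ⟩
    parity n                      ∎
    where
    module o = OppositeFlip o
    open Circle n (toℕ a)
    open ≡-Reasoning

  -- The n flips are distinct: for odd n the antipode of an even point a is odd, so the flip at a
  -- creates the diameter through a. Two different diameters cross, hence q contains at most one.
  odd-degree : parity n ≡ 1ℙ → DegreeIs n p n
  odd-degree odd-n = card-≡ (λ j → OppositeFlip.q (at j)) (λ j → OppositeFlip.neighbour (at j))
      (λ j → _ , _ , OppositeFlip.flip (at j) , OppositeFlip.facing (at j) , toℕ-double (toℕ j) (toℕ<n j))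
      (λ {i} {j} eq → toℕ-injective (double-injective (toℕ i) (toℕ j) (toℕ<n i) (toℕ<n j) (injective i j eq)))
    where
    open Charging ChargedTo charge charge-injective
    at : ∀ j → OppositeFlip (double (toℕ j) (toℕ<n j))
    at j = flip-at (toℕ j) (toℕ<n j)

    even≢antipode : ∀ {a b} (o : OppositeFlip a) → IsEven a → IsEven b → b ≢ OppositeFlip.w o
    even≢antipode o even-a even-b refl = case trans (sym even-b) (trans (antipode-parity o even-a) odd-n) of λ ()

    diameter : ∀ {a} (o : OppositeFlip a) → IsEven a → OppositeFlip.q o ⟨ a ⟩ ≡ OppositeFlip.w o
    diameter o even-a with OppositeFlip.w~c o
    ... | inj₁ w≡c  = ⊥-elim (even≢antipode o even-a (Flip.even-c (OppositeFlip.flip o)) (sym w≡c))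
    ... | inj₂ w≡pc = trans (Flip.at-a (OppositeFlip.flip o)) (sym w≡pc)

    same-end : ∀ {a a′} (o : OppositeFlip a) (o′ : OppositeFlip a′) → IsEven a → IsEven a′ →
               OppositeFlip.q o ≡ OppositeFlip.q o′ → a ≡ a′
    same-end {a} {a′} o o′ even-a even-a′ q≡q′ with a Fin.≟ a′
    ... | yes a≡a′ = a≡a′
    ... | no  a≢a′ = ⊥-elim (proj₂ (proj₂ (proj₁ o.neighbour)) a a′
      (subst₂ (λ x y → Crosses a x a′ y) (sym (diameter o even-a)) (sym (trans (cong (_⟨ a′ ⟩) q≡q′) (diameter o′ even-a′)))
        (arith 7 (λ W W′ n a a′ w w′ → W :≡ a :+ n :⇒ W′ :≡ a′ :+ n :⇒
             a :< 2 :* n :⇒ a′ :< 2 :* n :⇒ w :< 2 :* n :⇒ w′ :< 2 :* n :⇒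
             :Lift n a w W :⇒ :Lift n a′ w′ W′ :⇒ :¬ (a :≡ a′) :⇒ :¬ (a′ :≡ w) :⇒ :Cross a w a′ w′)
          (Circle.pos n (toℕ a) o.w) (Circle.pos n (toℕ a′) o′.w) n (toℕ a) (toℕ a′) (toℕ o.w) (toℕ o′.w)
          o.antipodal o′.antipodal (toℕ<n a) (toℕ<n a′) (toℕ<n o.w) (toℕ<n o′.w)
          (Circle.pos-spec n (toℕ a) o.w) (Circle.pos-spec n (toℕ a′) o′.w)
          (a≢a′ ∘ toℕ-injective) (even≢antipode o even-a even-a′ ∘ toℕ-injective))))
      where
      module o  = OppositeFlip o
      module o′ = OppositeFlip o′

    injective : ∀ i j → OppositeFlip.q (at i) ≡ OppositeFlip.q (at j) →
                double (toℕ i) (toℕ<n i) ≡ double (toℕ j) (toℕ<n j)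
    injective i j = same-end (at i) (at j) (double-even (toℕ i) (toℕ<n i)) (double-even (toℕ j) (toℕ<n j))

  -- The h flips are distinct: for even n the antipode of a is the even end c. By `flip-vertex` and
  -- parity, an equal flip at a′ has a′ equal to a or to that antipode, and the latter is impossible
  -- since a and a′ are both below n.
  even-degree : ∀ h → n ≡ 2 * h → DegreeIs n p h
  even-degree h n≡2h = card-≡ (λ j → OppositeFlip.q (at j)) (λ j → OppositeFlip.neighbour (at j))
      (λ j → _ , _ , OppositeFlip.flip (at j) , OppositeFlip.facing (at j) , inj₁ (toℕ-double (toℕ j) (below j)))
      (λ {i} {j} eq → toℕ-injective (double-injective (toℕ i) (toℕ j) (below i) (below j) (injective i j eq)))
    where
    open Charging (HalfChargedTo {h}) (halfCharge n≡2h) (halfCharge-injective n≡2h)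
    below : ∀ (j : Fin h) → toℕ j < n
    below j = arith 3 (λ j h n → j :< h :⇒ n :≡ 2 :* h :⇒ j :< n) (toℕ j) h n (toℕ<n j) n≡2h

    at : ∀ j → OppositeFlip (double (toℕ j) (below j))
    at j = flip-at (toℕ j) (below j)

    small : ∀ j → toℕ (double (toℕ j) (below j)) < n
    small j = subst₂ _<_ (sym (toℕ-double (toℕ j) (below j))) (sym n≡2h) (*-monoʳ-< 2 (toℕ<n j))

    even-n : parity n ≡ 0ℙ
    even-n = trans (cong parity n≡2h) (parity-+2* 0 h)

    same-end : ∀ {a a′} (o : OppositeFlip a) (o′ : OppositeFlip a′) → toℕ a < n → toℕ a′ < n →
               OppositeFlip.q o ≡ OppositeFlip.q o′ → a ≡ a′
    same-end {a} {a′} o o′ a<n a′<n q≡q′ =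
      Sum.[ sym ∘ even-~⇒≡ even-a′ even-a
          , (λ a′~c → ⊥-elim (opposite (even-~⇒≡ even-a′ even-w (~-trans a′~c (~-sym o.w~c))))) ]′
        (flip-vertex o.flip (subst (λ q → Flip q a′ o′.c) (sym q≡q′) o′.flip))
      where
      module o  = OppositeFlip o
      module o′ = OppositeFlip o′
      even-a  = Flip.even-a o.flip
      even-a′ = Flip.even-a o′.flip
      even-w : IsEven o.w
      even-w = trans (antipode-parity o even-a) even-n
      opposite : a′ ≢ o.w
      opposite eq = arith 5 (λ W n a w a′ → W :≡ a :+ n :⇒ :Lift n a w W :⇒ a :< n :⇒ a′ :< n :⇒ :¬ (a′ :≡ w))
        (Circle.pos n (toℕ a) o.w) n (toℕ a) (toℕ o.w) (toℕ a′)
        o.antipodal (Circle.pos-spec n (toℕ a) o.w) a<n a′<n (cong toℕ eq)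

    injective : ∀ i j → OppositeFlip.q (at i) ≡ OppositeFlip.q (at j) →
                double (toℕ i) (below i) ≡ double (toℕ j) (below j)
    injective i j = same-end (at i) (at j) (small i) (small j)

-- The two matchings by perimeter edges

Adjacent : ℕ → ℕ → ℕ → Set
Adjacent n x y = y ≡ 1 + x ⊎ x ≡ 1 + y ⊎ (x ≡ 0 × 1 + y ≡ 2 * n) ⊎ (y ≡ 0 × 1 + x ≡ 2 * n)

:Adjacent : ∀ {k} → Expr k → Expr k → Expr k → Formula k
:Adjacent n x y = y :≡ con 1 :+ x :∨ x :≡ con 1 :+ y :∨
  (x :≡ con 0 :∧ con 1 :+ y :≡ 2 :* n) :∨ (y :≡ con 0 :∧ con 1 :+ x :≡ 2 :* n)

adjacent⇒thin : ∀ n (p : Conf n) a → Adjacent n (toℕ a) (toℕ (p ⟨ a ⟩)) → Thin p a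
adjacent⇒thin n p a adjacent = Sum.map
  (λ cond x → arith 3 (λ a b x → b :≡ con 1 :+ a :∨ a :≡ con 1 :+ b :⇒ :¬ :In a b x)
                (toℕ a) (toℕ (p ⟨ a ⟩)) (toℕ x) cond)
  (λ cond x → arith 4 (λ n a b x → (a :≡ con 0 :∧ con 1 :+ b :≡ 2 :* n) :∨ (b :≡ con 0 :∧ con 1 :+ a :≡ 2 :* n) :⇒
                                   x :< 2 :* n :⇒ :¬ :Out a b x)
                n (toℕ a) (toℕ (p ⟨ a ⟩)) (toℕ x) cond (toℕ<n x))
  (Sum.assocˡ adjacent)

thin⇒adjacent : ∀ n (p : Conf n) → IsMatching p → ∀ a → Thin p a → Adjacent n (toℕ a) (toℕ (p ⟨ a ⟩))
thin⇒adjacent n p isMatching a (inj₁ none) =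
  arith 3 (λ n a b → :¬ (b :≡ a) :⇒ :¬ (con 1 :+ a :< b) :⇒ :¬ (con 1 :+ b :< a) :⇒ :Adjacent n a b)
    n (toℕ a) (toℕ (p ⟨ a ⟩)) (proj₁ isMatching a ∘ toℕ-injective)
    (λ gap → let x<2n = <-trans gap (toℕ<n _) in none (fromℕ< x<2n)
      (inj₁ (subst (λ x → toℕ a < x × x < toℕ (p ⟨ a ⟩)) (sym (toℕ-fromℕ< x<2n)) (n<1+n _ , gap))))
    (λ gap → let x<2n = <-trans gap (toℕ<n _) in none (fromℕ< x<2n)
      (inj₂ (subst (λ x → toℕ (p ⟨ a ⟩) < x × x < toℕ a) (sym (toℕ-fromℕ< x<2n)) (n<1+n _ , gap))))
thin⇒adjacent n p isMatching a (inj₂ none) =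
  arith 3 (λ n a b → :¬ (b :≡ a) :⇒ a :< 2 :* n :⇒ b :< 2 :* n :⇒ :¬ (con 0 :< a :∧ con 0 :< b) :⇒
             :¬ (con 1 :+ a :< 2 :* n :∧ con 1 :+ b :< 2 :* n) :⇒ :Adjacent n a b)
    n (toℕ a) (toℕ (p ⟨ a ⟩)) (proj₁ isMatching a ∘ toℕ-injective) (toℕ<n a) (toℕ<n _)
    (λ (0<a , 0<b) → let 0<2n = <-trans 0<a (toℕ<n a) in none (fromℕ< 0<2n)
      (inj₁ (subst (λ x → x < toℕ a × x < toℕ (p ⟨ a ⟩)) (sym (toℕ-fromℕ< 0<2n)) (0<a , 0<b))))
    (λ (a< , b<) → let x<2n = ⊔-lub a< b< in none (fromℕ< x<2n)
      (inj₂ (subst (λ x → toℕ a < x × toℕ (p ⟨ a ⟩) < x) (sym (toℕ-fromℕ< x<2n))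
        (m≤m⊔n (suc (toℕ a)) (suc (toℕ (p ⟨ a ⟩))) , m≤n⊔m (suc (toℕ a)) (suc (toℕ (p ⟨ a ⟩)))))))

toggle : ℕ → ℕ
toggle 0             = 1
toggle 1             = 0
toggle (suc (suc x)) = suc (suc (toggle x))

toggle-involutive : ∀ x → toggle (toggle x) ≡ x
toggle-involutive 0             = refl
toggle-involutive 1             = refl
toggle-involutive (suc (suc x)) = cong (2 +_) (toggle-involutive x)

toggle-adjacent : ∀ x → toggle x ≡ 1 + x ⊎ x ≡ 1 + toggle x
toggle-adjacent 0             = inj₁ refl
toggle-adjacent 1             = inj₂ refl
toggle-adjacent (suc (suc x)) = Sum.map (cong (2 +_)) (cong (2 +_)) (toggle-adjacent x)

toggle-< : ∀ k x → x < 2 * k → toggle x < 2 * k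
toggle-< (suc k) 0 _ = arith 1 (λ k → con 1 :< 2 :* (con 1 :+ k)) k
toggle-< (suc k) 1 _ = arith 1 (λ k → con 0 :< 2 :* (con 1 :+ k)) k
toggle-< (suc k) (suc (suc x)) h =
  arith 2 (λ k y → y :< 2 :* k :⇒ con 2 :+ y :< 2 :* (con 1 :+ k)) k (toggle x)
    (toggle-< k x (arith 2 (λ k x → con 2 :+ x :< 2 :* (con 1 :+ k) :⇒ x :< 2 :* k) k x h))

-- The same pairing moved by one step around a circle with 2(k + 1) points.
rotated : ℕ → ℕ → ℕ
rotated k zero = suc (2 * k)
rotated k (suc x) with x <? 2 * k
... | yes _ = suc (toggle x)
... | no  _ = 0

rotated-inner : ∀ k x → x < 2 * k → rotated k (suc x) ≡ suc (toggle x)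
rotated-inner k x x<2k with x <? 2 * k
... | yes _   = refl
... | no x≮2k = ⊥-elim (x≮2k x<2k)

rotated-last : ∀ k x → ¬ x < 2 * k → rotated k (suc x) ≡ 0
rotated-last k x x≮2k with x <? 2 * k
... | yes x<2k = ⊥-elim (x≮2k x<2k)
... | no _     = refl

last-point : ∀ k x → suc x < 2 * suc k → ¬ x < 2 * k → x ≡ 2 * k
last-point = arith 2 (λ k x → con 1 :+ x :< 2 :* (con 1 :+ k) :⇒ :¬ (x :< 2 :* k) :⇒ x :≡ 2 :* k)

rotated-involutive : ∀ k x → x < 2 * suc k → rotated k (rotated k x) ≡ x
rotated-involutive k zero _ = rotated-last k (2 * k) (<-irrefl refl)
rotated-involutive k (suc x) x< with x <? 2 * k
... | yes x<2k = trans (rotated-inner k (toggle x) (toggle-< k x x<2k)) (cong suc (toggle-involutive x))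
... | no  x≮2k = cong suc (sym (last-point k x x< x≮2k))

rotated-adjacent : ∀ k x → x < 2 * suc k → Adjacent (suc k) x (rotated k x)
rotated-adjacent k zero _ = inj₂ (inj₂ (inj₁ (refl , sym (*-suc 2 k))))
rotated-adjacent k (suc x) x< with x <? 2 * k
... | yes _    = Sum.map (cong suc) (inj₁ ∘ cong suc) (toggle-adjacent x)
... | no  x≮2k = inj₂ (inj₂ (inj₂ (refl , trans (cong (2 +_) (last-point k x x< x≮2k)) (sym (*-suc 2 k)))))

rotated-< : ∀ k x → x < 2 * suc k → rotated k x < 2 * suc k
rotated-< k zero _ = arith 1 (λ k → con 1 :+ 2 :* k :< 2 :* (con 1 :+ k)) k
rotated-< k (suc x) x< with x <? 2 * k
... | yes x<2k = arith 2 (λ k y → y :< 2 :* k :⇒ con 1 :+ y :< 2 :* (con 1 :+ k)) k (toggle x) (toggle-< k x x<2k)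
... | no  _    = arith 1 (λ k → con 0 :< 2 :* (con 1 :+ k)) k

module FromFunction (n : ℕ) (2≤n : 2 ≤ n) (f : ℕ → ℕ) (f-< : ∀ x → x < 2 * n → f x < 2 * n)
  (f-involutive : ∀ x → x < 2 * n → f (f x) ≡ x) (f-adjacent : ∀ x → x < 2 * n → Adjacent n x (f x)) where

  conf : Conf n
  conf = tabulate (λ i → fromℕ< (f-< (toℕ i) (toℕ<n i)))

  toℕ-conf : ∀ i → toℕ (conf ⟨ i ⟩) ≡ f (toℕ i)
  toℕ-conf i = trans (cong toℕ (lookup∘tabulate _ i)) (toℕ-fromℕ< _)

  conf-adjacent : ∀ i → Adjacent n (toℕ i) (toℕ (conf ⟨ i ⟩))
  conf-adjacent i = subst (Adjacent n (toℕ i)) (sym (toℕ-conf i)) (f-adjacent (toℕ i) (toℕ<n i))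

  conf-thin : ∀ g → Thin conf g
  conf-thin g = adjacent⇒thin n conf g (conf-adjacent g)

  -- Adjacent points bound an empty side, so non-crossing follows from thinness.
  conf-isMatching : IsMatching conf
  conf-isMatching =
    (λ i eq → arith 3 (λ n x y → con 2 :≤ n :⇒ :Adjacent n x y :⇒ :¬ (y :≡ x))
      n (toℕ i) _ 2≤n (conf-adjacent i) (cong toℕ eq)) ,
    (λ i → toℕ-injective (trans (toℕ-conf _) (trans (cong f (toℕ-conf i)) (f-involutive (toℕ i) (toℕ<n i))))) ,
    (λ i j → thin-noncrossing conf i (conf-thin i) j (conf ⟨ j ⟩))

agree-on-even : ∀ {m} {p q : Conf′ m} → IsMatching p → IsMatching q → (∀ x → IsEven x → p ⟨ x ⟩ ≡ q ⟨ x ⟩) → p ≡ q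
agree-on-even {p = p} {q} isMatching-p isMatching-q agree = lookup-extensional p q everywhere
  where
  module p = Matching p isMatching-p
  module q = Matching q isMatching-q
  everywhere : ∀ x → p ⟨ x ⟩ ≡ q ⟨ x ⟩
  everywhere x with p.even-end x
  ... | e , even-e , inj₁ refl = agree e even-e
  ... | e , even-e , inj₂ refl = trans (sym (q.involutive (p ⟨ x ⟩)))
    (cong (q ⟨_⟩) (trans (sym (agree e even-e)) (p.involutive x)))

module Perimeter (n : ℕ) (2≤n : 2 ≤ n) (p : Conf n) (isMatching : IsMatching p) (thin : ∀ g → Thin p g) where

  open Matching p isMatching

  adjacent : ∀ x → Adjacent n (toℕ x) (toℕ (p ⟨ x ⟩))
  adjacent x = thin⇒adjacent n p isMatching x (thin x)

  0<2n : 0 < 2 * n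
  0<2n = arith 1 (λ n → con 2 :≤ n :⇒ con 0 :< 2 :* n) n 2≤n

  origin : Pt n
  origin = fromℕ< 0<2n

  partner-of : ∀ {x y} t → toℕ (p ⟨ x ⟩) ≡ t → toℕ y ≡ t → toℕ (p ⟨ y ⟩) ≡ toℕ x
  partner-of {x} {y} t px≡t y≡t =
    cong toℕ (trans (cong (p ⟨_⟩) (sym (toℕ-injective (trans px≡t (sym y≡t))))) (involutive x))

  origin-adjacent : toℕ (p ⟨ origin ⟩) ≡ 1 ⊎ suc (toℕ (p ⟨ origin ⟩)) ≡ 2 * n
  origin-adjacent = arith 3 (λ n x y → x :≡ con 0 :⇒ con 2 :≤ n :⇒ :Adjacent n x y :⇒ y :≡ con 1 :∨ con 1 :+ y :≡ 2 :* n)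
    n (toℕ origin) _ (toℕ-fromℕ< 0<2n) 2≤n (adjacent origin)

  forward : toℕ (p ⟨ origin ⟩) ≡ 1 → ∀ k x → toℕ x ≡ 2 * k → toℕ (p ⟨ x ⟩) ≡ 1 + 2 * k
  forward p0≡1 zero x x≡0 = trans (cong (λ x → toℕ (p ⟨ x ⟩)) (toℕ-injective (trans x≡0 (sym (toℕ-fromℕ< 0<2n))))) p0≡1
  forward p0≡1 (suc k) x x≡ =
    -- The wrap-around case 1 + x = 2n with x even is absurd by parity only, which `arith` cannot
    -- see. It is excluded by the extra hypothesis that a point matched to 0 must be 1.
    arith 5 (λ n k x px y → x :≡ 2 :* (con 1 :+ k) :⇒ y :≡ 2 :* k :⇒ :Adjacent n x px :⇒
               (px :≡ con 1 :+ 2 :* k :⇒ x :≡ y) :⇒ (px :≡ con 0 :⇒ x :≡ con 1) :⇒ px :≡ con 1 :+ 2 :* (con 1 :+ k))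
      n k (toℕ x) (toℕ (p ⟨ x ⟩)) (toℕ y) x≡ y≡ (adjacent x)
      (λ px≡ → trans (cong toℕ (sym (involutive x))) (partner-of (1 + 2 * k) (forward p0≡1 k y y≡) px≡))
      (λ px≡0 → trans (cong toℕ (sym (involutive x)))
        (trans (cong (toℕ ∘ (p ⟨_⟩)) (toℕ-injective (trans px≡0 (sym (toℕ-fromℕ< 0<2n))))) p0≡1))
    where
    y<2n : 2 * k < 2 * n
    y<2n = arith 3 (λ n k x → x :≡ 2 :* (con 1 :+ k) :⇒ x :< 2 :* n :⇒ 2 :* k :< 2 :* n) n k (toℕ x) x≡ (toℕ<n x)
    y = fromℕ< y<2n
    y≡ : toℕ y ≡ 2 * k
    y≡ = toℕ-fromℕ< y<2n

  -- The bound on k excludes the last point, which is matched to 0, and with it the wrap-around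
  -- case.
  backward : suc (toℕ (p ⟨ origin ⟩)) ≡ 2 * n →
             ∀ k x → toℕ x ≡ 1 + 2 * k → 2 + 2 * k < 2 * n → toℕ (p ⟨ x ⟩) ≡ 2 + 2 * k
  backward p0≡last zero x x≡1 _ =
    arith 4 (λ n x px p0 → con 1 :+ p0 :≡ 2 :* n :⇒ con 2 :≤ n :⇒ x :≡ con 1 :⇒ :Adjacent n x px :⇒
               (px :≡ con 0 :⇒ p0 :≡ x) :⇒ px :≡ con 2)
      n (toℕ x) (toℕ (p ⟨ x ⟩)) (toℕ (p ⟨ origin ⟩)) p0≡last 2≤n x≡1 (adjacent x)
      (λ px≡0 → partner-of 0 px≡0 (toℕ-fromℕ< 0<2n))
  backward p0≡last (suc k) x x≡ x+1<2n =
    arith 5 (λ n k x px y → x :≡ con 1 :+ 2 :* (con 1 :+ k) :⇒ con 2 :+ 2 :* (con 1 :+ k) :< 2 :* n :⇒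
               y :≡ con 1 :+ 2 :* k :⇒
               :Adjacent n x px :⇒ (px :≡ con 2 :+ 2 :* k :⇒ x :≡ y) :⇒ px :≡ con 2 :+ 2 :* (con 1 :+ k))
      n k (toℕ x) (toℕ (p ⟨ x ⟩)) (toℕ y) x≡ x+1<2n y≡ (adjacent x)
      (λ px≡ → trans (cong toℕ (sym (involutive x))) (partner-of (2 + 2 * k) (backward p0≡last k y y≡ y+1<2n) px≡))
    where
    y+1<2n : 2 + 2 * k < 2 * n
    y+1<2n = arith 2 (λ n k → con 2 :+ 2 :* (con 1 :+ k) :< 2 :* n :⇒ con 2 :+ 2 :* k :< 2 :* n) n k x+1<2n
    y = fromℕ< (<-trans (n<1+n (1 + 2 * k)) y+1<2n)
    y≡ : toℕ y ≡ 1 + 2 * k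
    y≡ = toℕ-fromℕ< _

  backward-even : suc (toℕ (p ⟨ origin ⟩)) ≡ 2 * n → ∀ k x → toℕ x ≡ 2 * suc k → toℕ (p ⟨ x ⟩) ≡ 1 + 2 * k
  backward-even p0≡last k x x≡ = trans (partner-of (2 + 2 * k) (backward p0≡last k y y≡ y+1<2n) (trans x≡ (*-suc 2 k))) y≡
    where
    y+1<2n : 2 + 2 * k < 2 * n
    y+1<2n = subst (_< 2 * n) (trans x≡ (*-suc 2 k)) (toℕ<n x)
    y = fromℕ< (<-trans (n<1+n (1 + 2 * k)) y+1<2n)
    y≡ : toℕ y ≡ 1 + 2 * k
    y≡ = toℕ-fromℕ< _

module Rigidity (n : ℕ) (2≤n : 2 ≤ n) {p q : Conf n} (isMatching-p : IsMatching p) (isMatching-q : IsMatching q)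
  (thin-p : ∀ g → Thin p g) (thin-q : ∀ g → Thin q g) where

  private
    module p = Perimeter n 2≤n p isMatching-p thin-p
    module q = Perimeter n 2≤n q isMatching-q thin-q

  forward-unique : toℕ (p ⟨ p.origin ⟩) ≡ 1 → toℕ (q ⟨ p.origin ⟩) ≡ 1 → p ≡ q
  forward-unique p0≡1 q0≡1 = agree-on-even isMatching-p isMatching-q agree
    where
    agree : ∀ x → IsEven x → p ⟨ x ⟩ ≡ q ⟨ x ⟩
    agree x even-x with even⇒double (toℕ x) even-x
    ... | k , x≡2k = toℕ-injective (trans (p.forward p0≡1 k x x≡2k) (sym (q.forward q0≡1 k x x≡2k)))

  backward-unique : suc (toℕ (p ⟨ p.origin ⟩)) ≡ 2 * n → suc (toℕ (q ⟨ p.origin ⟩)) ≡ 2 * n → p ≡ q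
  backward-unique p0≡last q0≡last = agree-on-even isMatching-p isMatching-q agree
    where
    agree : ∀ x → IsEven x → p ⟨ x ⟩ ≡ q ⟨ x ⟩
    agree x even-x with even⇒double (toℕ x) even-x
    ... | zero  , x≡0  with refl ← toℕ-injective {i = x} {j = p.origin} (trans x≡0 (sym (toℕ-fromℕ< p.0<2n))) =
      toℕ-injective (suc-injective (trans p0≡last (sym q0≡last)))
    ... | suc k , x≡2k =
      toℕ-injective (trans (p.backward-even p0≡last k x x≡2k) (sym (q.backward-even q0≡last k x x≡2k)))

module PerimeterMatchings (k : ℕ) (2≤n : 2 ≤ suc k) where

  private
    n = suc k

  module Forward = FromFunction n 2≤n toggle (toggle-< n) (λ x _ → toggle-involutive x)
    (λ x _ → Sum.map id inj₁ (toggle-adjacent x))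
  module Backward = FromFunction n 2≤n (rotated k) (rotated-< k) (rotated-involutive k) (rotated-adjacent k)

  exactly-two : HasCard (λ (p : Conf n) → IsMatching p × AllPerimeter n p) 2
  exactly-two = Forward.conf ∷ Backward.conf ∷ [] , (different ∷ []) ∷ [] ∷ [] , (λ p → mk⇔ to from) , refl
    where
    open Perimeter n 2≤n Forward.conf Forward.conf-isMatching Forward.conf-thin using (origin; 0<2n)

    origin≡0 : toℕ origin ≡ 0
    origin≡0 = toℕ-fromℕ< 0<2n

    forward-origin : toℕ (Forward.conf ⟨ origin ⟩) ≡ 1
    forward-origin = trans (Forward.toℕ-conf origin) (cong toggle origin≡0)

    backward-origin : suc (toℕ (Backward.conf ⟨ origin ⟩)) ≡ 2 * n
    backward-origin = trans (cong suc (trans (Backward.toℕ-conf origin) (cong (rotated k) origin≡0))) (sym (*-suc 2 k))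

    different : Forward.conf ≢ Backward.conf
    different eq = arith 2 (λ n x → con 2 :≤ n :⇒ x :≡ con 1 :⇒ con 1 :+ x :≡ 2 :* n :⇒ :⊥)
      n (toℕ (Backward.conf ⟨ origin ⟩)) 2≤n
      (trans (cong (λ p → toℕ (p ⟨ origin ⟩)) (sym eq)) forward-origin) backward-origin

    to : ∀ {p} → p ∈ Forward.conf ∷ Backward.conf ∷ [] → IsMatching p × AllPerimeter n p
    to (here refl)         = Forward.conf-isMatching , λ a → thin⇒perimeter n Forward.conf a (Forward.conf-thin a)
    to (there (here refl)) = Backward.conf-isMatching , λ a → thin⇒perimeter n Backward.conf a (Backward.conf-thin a)

    from : ∀ {p} → IsMatching p × AllPerimeter n p → p ∈ Forward.conf ∷ Backward.conf ∷ []
    from {p} (isMatching , perimeter) = Sum.[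
        (λ p0≡1 → here (Rigidity.forward-unique n 2≤n
          isMatching Forward.conf-isMatching thin Forward.conf-thin p0≡1 forward-origin)) ,
        (λ p0≡last → there (here (Rigidity.backward-unique n 2≤n
          isMatching Backward.conf-isMatching thin Backward.conf-thin p0≡last backward-origin))) ]′
        (Perimeter.origin-adjacent n 2≤n p isMatching thin)
      where
      thin : ∀ g → Thin p g
      thin g = perimeter⇒thin n p isMatching g (perimeter g)

-- The theorem for odd and for even n

odd-case : ∀ n → 3 ≤ n → n % 2 ≡ 1 → MaxDegreeIs n n ×
  ((p : Conf n) → IsMatching p → (DegreeIs n p n ⇔ AllPerimeter n p)) ×
  HasCard (λ (p : Conf n) → IsMatching p × AllPerimeter n p) 2
odd-case n@(suc k) 3≤n n%2≡1 =
  (upper , Forward.conf , Forward.conf-isMatching , degree Forward.conf Forward.conf-isMatching Forward.conf-thin) ,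
  (λ p isMatching → mk⇔ (Extremal.full-degree⇒perimeter n p isMatching)
    (λ perimeter → degree p isMatching (λ g → perimeter⇒thin n p isMatching g (perimeter g)))) ,
  exactly-two
  where
  2≤n : 2 ≤ n
  2≤n = ≤-trans (n≤1+n 2) 3≤n
  open PerimeterMatchings k 2≤n

  odd-n : parity n ≡ 1ℙ
  odd-n = trans (cong parity (trans (m≡m%n+[m/n]*n n 2) (cong₂ _+_ n%2≡1 (*-comm (n / 2) 2)))) (parity-+2* 1 (n / 2))

  degree : ∀ p → IsMatching p → (∀ g → Thin p g) → DegreeIs n p n
  degree p isMatching thin = ThinDegree.odd-degree n 2≤n p isMatching thin odd-n

  upper : ∀ p d → IsMatching p → DegreeIs n p d → d ≤ n
  upper p d isMatching = Charging.card-≤ D.ChargedTo D.charge D.charge-injective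
    where module D = Degree n p isMatching

even-case : ∀ n → 2 ≤ n → n % 2 ≡ 0 → MaxDegreeIs n (n / 2)
even-case n@(suc k) 2≤n n%2≡0 =
  upper , Forward.conf , Forward.conf-isMatching ,
  ThinDegree.even-degree n 2≤n Forward.conf Forward.conf-isMatching Forward.conf-thin (n / 2) n≡2h
  where
  open PerimeterMatchings k 2≤n

  n≡2h : n ≡ 2 * (n / 2)
  n≡2h = trans (m≡m%n+[m/n]*n n 2) (cong₂ _+_ n%2≡0 (*-comm (n / 2) 2))

  upper : ∀ p d → IsMatching p → DegreeIs n p d → d ≤ n / 2
  upper p d isMatching = Charging.card-≤ D.HalfChargedTo (D.halfCharge n≡2h) (D.halfCharge-injective n≡2h)
    where module D = Degree n p isMatching

theorem4 : ((n : ℕ) → 3 ≤ n → n % 2 ≡ 1 →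
    MaxDegreeIs n n ×
    ((p : Conf n) → IsMatching p → (DegreeIs n p n ⇔ AllPerimeter n p)) ×
    HasCard (λ (p : Conf n) → IsMatching p × AllPerimeter n p) 2) ×
    ((n : ℕ) → 2 ≤ n → n % 2 ≡ 0 → MaxDegreeIs n (n / 2))
theorem4 = odd-case , even-case
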